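{- Let $\mathcal A=\{a_1,a_2\}$, let $w=w_0w_1w_2\ldots$ be a one-sided infinite fixed word of a substitution on $\mathcal A$, and let the tile lengths $|I_1|,|I_2|>0$ (for $a_1,a_2$ respectively) be algebraic numbers. Let $0=t_0<t_1<\cdots$ be the geometric realisation of $w$ and $G(X)=\sum_{n\ge0}t_nX^n$. Then exactly one of the following holds: (a) $|I_1|=|I_2|$; in this case $G(X)=\frac{|I_1|X}{(1-X)^2}$. (b) $|I_1|\ne|I_2|$ and $w$ is eventually periodic; in this case there exist $P\in\mathbb{Q}[X]$ and an integer $d\ge1$ such that \[G(X)=(|I_1|-|I_2|)\frac{XP(X)}{(1-X)(1-X^d)}+|I_1|\frac{X}{(1-X)^2}.\] (c) $|I_1|\ne|I_2|$ and $w$ is not eventually periodic; in this case $G(X)$ is transcendental over $\mathbb{Q}(X)$.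
   Context: The geometric realisation of $w$: replace each letter $w_n=a_j$ by a translated copy of an interval $I_j$ of length $|I_j|$, placed consecutively starting at the origin and proceeding to the right with no gaps, in the order $w_0,w_1,\dots$; $t_n$ is the left endpoint of the interval corresponding to $w_n$. A word is eventually periodic if there exist $N$, $d\ge1$ with $w_{n+d}=w_n$ for all $n\ge N$. Transcendence over $\mathbb{Q}(X)$ is meant inside $\mathbb{C}((X))$. -}

module Defs where

open import Level using (Level; 0ℓ; _⊔_) renaming (suc to lsuc)
open import Algebra.Bundles using (CommutativeRing)
open import Algebra.Bundles.Raw using (RawRing)
import Algebra.Definitions.RawSemiring as RawSemiringDefs
open import Data.Fin.Base using (toℕ)
open import Data.Integer.Base using (ℤ; +_; -[1+_])
open import Data.List.Base using (List; []; _∷_; map)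
open import Data.List.NonEmpty.Base using (List⁺; _∷_)
open import Data.List.Relation.Unary.All using (All)
open import Data.List.Relation.Unary.Any using (Any)
open import Data.Nat.Base as ℕ using (ℕ; zero; suc; _∸_)
open import Data.Product.Base using (Σ-syntax; ∃-syntax; _×_; _,_)
open import Data.Rational.Base using (ℚ; ↥_; ↧_)
open import Data.Sum.Base using (_⊎_)
open import Function.Base using (_∘_)
open import Relation.Binary.Core using (Rel)
open import Relation.Binary.Structures using (IsTotalOrder)
open import Relation.Binary.PropositionalEquality.Core using (_≡_)
open import Relation.Nullary.Negation.Core using (¬_)
open import Relation.Unary using (Pred)

private
  variable
    a b c : Level

ExactlyOne : Set a → Set b → Set c → Set (a ⊔ b ⊔ c)
ExactlyOne A B C =
    (A × ¬ B × ¬ C)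
  ⊎ (¬ A × B × ¬ C)
  ⊎ (¬ A × ¬ B × C)

data Letter : Set where
  a₁ a₂ : Letter

InfiniteWord : Set
InfiniteWord = ℕ → Letter

Substitution : Set
Substitution = Letter → List⁺ Letter

-- concatenate u v is the infinite concatenation u · v 0 · v 1 · v 2 ⋯
concatenate : {A : Set a} → List⁺ A → (ℕ → List⁺ A) → ℕ → A
concatenate (x ∷ _)      v zero    = x
concatenate (x ∷ y ∷ ys) v (suc n) = concatenate (y ∷ ys) v n
concatenate (x ∷ [])     v (suc n) = concatenate (v 0) (v ∘ suc) n

_⟪_⟫ : Substitution → InfiniteWord → InfiniteWord
σ ⟪ w ⟫ = concatenate (σ (w 0)) (σ ∘ w ∘ suc)

_IsFixedBy_ : InfiniteWord → Substitution → Set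
w IsFixedBy σ = ∀ n → (σ ⟪ w ⟫) n ≡ w n

EventuallyPeriodic : InfiniteWord → Set
EventuallyPeriodic w =
  ∃[ N ] ∃[ d ] (1 ℕ.≤ d × (∀ n → N ℕ.≤ n → w (n ℕ.+ d) ≡ w n))

-- A subfield F of R is given by its membership predicate.
module Algebraicity {c ℓ} (R : RawRing c ℓ) where
  open RawRing R
  open RawSemiringDefs rawSemiring using () renaming (_×_ to _·_)

  fromℤ : ℤ → Carrier
  fromℤ (+ n)    = n · 1#
  fromℤ -[1+ n ] = - (suc n · 1#)

  infix 4 _≈_/_

  -- F = A / B in a field
  _≈_/_ : Carrier → Carrier → Carrier → Set ℓ
  F ≈ A / B = B ≉ 0# × F * B ≈ A

  -- The prime field ℚ ⊆ R (for R of characteristic zero).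
  Rational : Pred Carrier ℓ
  Rational x = Σ[ q ∈ ℚ ] (x ≈ fromℤ (↥ q) / fromℤ (↧ q))

  -- Coefficients are listed from the constant term upwards.
  eval : List Carrier → Carrier → Carrier
  eval []       x = 0#
  eval (k ∷ ks) x = k + x * eval ks x

  AlgebraicOver : ∀ {p} → Pred Carrier p → Pred Carrier (c ⊔ ℓ ⊔ p)
  AlgebraicOver F x =
    ∃[ ks ] (All F ks × Any (_≉ 0#) ks × eval ks x ≈ 0#)

  TranscendentalOver : ∀ {p} → Pred Carrier p → Pred Carrier (c ⊔ ℓ ⊔ p)
  TranscendentalOver F x = ¬ AlgebraicOver F x

module LaurentSeries {c ℓ} (R : RawRing c ℓ) where
  open RawRing R
  open RawSemiringDefs rawSemiring using (sum)

  -- (k , f) stands for X⁻ᵏ · Σₙ f(n) Xⁿ; f(0) may vanish, so the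
  -- representation is not unique.
  record Laurent : Set c where
    constructor _,_
    field
      pole   : ℕ
      coeffs : ℕ → Carrier

  -- multiplication of a power series by Xᵏ
  shift : ℕ → (ℕ → Carrier) → ℕ → Carrier
  shift zero    f n       = f n
  shift (suc k) f zero    = 0#
  shift (suc k) f (suc n) = shift k f n

  powerSeries : (ℕ → Carrier) → Laurent
  powerSeries f = 0 , f

  const : Carrier → Laurent
  const x = powerSeries λ { zero → x ; (suc _) → 0# }

  X : Laurent
  X = powerSeries (shift 1 λ { zero → 1# ; (suc _) → 0# })

  laurentRing : RawRing c ℓ
  laurentRing = record
    { Carrier = Laurent
    ; _≈_     = λ { (k , f) (l , g) → ∀ n → shift l f n ≈ shift k g n }
    ; _+_     = λ { (k , f) (l , g) → (k ℕ.+ l) , λ n → shift l f n + shift k g n }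
    ; _*_     = λ { (k , f) (l , g) → (k ℕ.+ l) ,
                    λ n → sum {suc n} λ i → f (toℕ i) * g (n ∸ toℕ i) }
    ; -_      = λ { (k , f) → k , λ n → - f n }
    ; 0#      = const 0#
    ; 1#      = const 1#
    }

-- The real numbers, characterised (classically, up to unique
-- isomorphism) as a Dedekind-complete ordered field.
record CompleteOrderedField : Set₁ where
  field
    commutativeRing : CommutativeRing 0ℓ 0ℓ

  open CommutativeRing commutativeRing public

  infix 4 _≤_ _<_

  field
    _≤_          : Rel Carrier 0ℓ
    isTotalOrder : IsTotalOrder _≈_ _≤_
    +-monoˡ-≤    : ∀ z {x y} → x ≤ y → x + z ≤ y + z
    *-nonNeg     : ∀ {x y} → 0# ≤ x → 0# ≤ y → 0# ≤ x * y
    0≉1          : 0# ≉ 1#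
    inverse      : ∀ x → x ≉ 0# → ∃[ y ] (x * y ≈ 1#)

  _<_ : Rel Carrier 0ℓ
  x < y = x ≤ y × x ≉ y

  UpperBound : Pred Carrier 0ℓ → Pred Carrier 0ℓ
  UpperBound S u = ∀ x → S x → x ≤ u

  field
    supremum : (S : Pred Carrier 0ℓ) → ∃[ x ] S x → ∃[ u ] UpperBound S u →
               ∃[ s ] (UpperBound S s × (∀ u → UpperBound S u → s ≤ u))

module Realisation (ℝ : CompleteOrderedField) where
  private module ℝ = CompleteOrderedField ℝ

  -- x + iy is the pair (x , y).
  ℂ : RawRing 0ℓ 0ℓ
  ℂ = record
    { Carrier = ℝ.Carrier × ℝ.Carrier
    ; _≈_     = λ { (x , y) (u , v) → x ℝ.≈ u × y ℝ.≈ v }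
    ; _+_     = λ { (x , y) (u , v) → x ℝ.+ u , y ℝ.+ v }
    ; _*_     = λ { (x , y) (u , v) → x ℝ.* u ℝ.- y ℝ.* v , x ℝ.* v ℝ.+ y ℝ.* u }
    ; -_      = λ { (x , y) → ℝ.- x , ℝ.- y }
    ; 0#      = ℝ.0# , ℝ.0#
    ; 1#      = ℝ.1# , ℝ.0#
    }

  private
    module ℂ  = RawRing ℂ
    module Aℂ = Algebraicity ℂ

  fromℝ : ℝ.Carrier → ℂ.Carrier
  fromℝ x = x , ℝ.0#

  AlgebraicNumber : Pred ℂ.Carrier 0ℓ
  AlgebraicNumber = Aℂ.AlgebraicOver Aℂ.Rational

  open LaurentSeries ℂ public using (Laurent; powerSeries; const; X)

  ℂ⦅X⦆ : RawRing 0ℓ 0ℓ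
  ℂ⦅X⦆ = LaurentSeries.laurentRing ℂ

  open RawRing ℂ⦅X⦆
  open RawSemiringDefs rawSemiring using (_^_)
  open Algebraicity ℂ⦅X⦆ using (_≈_/_; eval; TranscendentalOver)

  ℚ[X] : Pred Laurent 0ℓ
  ℚ[X] F = ∃[ ks ] (All Aℂ.Rational ks × F ≈ eval (map const ks) X)

  ℚ⟨X⟩ : Pred Laurent 0ℓ
  ℚ⟨X⟩ F = ∃[ A ] ∃[ B ] (ℚ[X] A × ℚ[X] B × F ≈ A / B)

  TranscendentalOverℚ⟨X⟩ : Pred Laurent 0ℓ
  TranscendentalOverℚ⟨X⟩ = TranscendentalOver ℚ⟨X⟩

  constℝ : ℝ.Carrier → Laurent
  constℝ = const ∘ fromℝ

  leftEndpoint : (Letter → ℝ.Carrier) → InfiniteWord → ℕ → ℝ.Carrier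
  leftEndpoint ∣I∣ w zero    = ℝ.0#
  leftEndpoint ∣I∣ w (suc n) = leftEndpoint ∣I∣ w n ℝ.+ ∣I∣ (w n)

  generatingSeries : (ℕ → ℝ.Carrier) → Laurent
  generatingSeries t = powerSeries (fromℝ ∘ t)

  -- G = ℓ X / (1 - X)²
  EqualLengthForm : ℝ.Carrier → Laurent → Set
  EqualLengthForm ℓ G = G ≈ (constℝ ℓ * X) / ((1# + - X) ^ 2)

  -- G = (ℓ₁ - ℓ₂) · X P / ((1 - X)(1 - Xᵈ)) + ℓ₁ · X / (1 - X)²
  -- for some P ∈ ℚ[X] and d ≥ 1; Q₁ and Q₂ name the two fractions.
  PeriodicForm : ℝ.Carrier → ℝ.Carrier → Laurent → Set
  PeriodicForm ℓ₁ ℓ₂ G =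
    ∃[ P ] ∃[ d ] (ℚ[X] P × 1 ℕ.≤ d ×
      ∃[ Q₁ ] ∃[ Q₂ ]
        ( Q₁ ≈ (X * P) / ((1# + - X) * (1# + - (X ^ d)))
        × Q₂ ≈ X / ((1# + - X) ^ 2)
        × G ≈ constℝ (ℓ₁ ℝ.- ℓ₂) * Q₁ + constℝ ℓ₁ * Q₂ ))

{-# OPTIONS --safe #-}

-- Only part (c) needs an idea: it is Fatou's theorem that an algebraic power series
-- f = Σ fₙ Xⁿ with finitely many distinct coefficients has an eventually periodic
-- coefficient sequence, applied to f = Σ |I|(wₙ) Xⁿ = G (1 − X) / X.
--
-- If G is algebraic over ℂ(X), then the field ℂ(X)(G) is finite-dimensional over ℂ(X)
-- and closed under θ = X d/dX, so f, θf, θ²f, … satisfy a linear relation over ℂ[X].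
-- Comparing coefficients gives polynomials p_s, not all zero, with
-- Σ_{s<N} p_s(n − s) f(n − s) = 0 for all large n. For a factor u of w of length N,
-- replacing the f(n − s) by the letters of u turns the left side into a polynomial in n;
-- it vanishes at every occurrence of u, hence identically if u occurs infinitely often.
-- Late factors of w all recur infinitely often, so the argument of the p_s may be
-- fixed at a value where they do not all vanish. This is a linear recurrence for f with
-- constant coefficients, by which N − 1 consecutive letters determine the next one, and
-- the pigeonhole principle applies.

module Submission where

open import Level using (0ℓ)
open import Algebra.Bundles using (CommutativeRing; RawRing; Semiring)
import Algebra.Construct.Pointwise as Pointwise
import Algebra.Definitions.RawSemiring as RawSemiringDefs
import Algebra.Properties.Ring as RingProperties
import Algebra.Properties.Semiring.Exp as SemiringPowers
import Algebra.Properties.Semiring.Mult as SemiringMultiples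
import Algebra.Properties.Semiring.Mult.TCOptimised as OptimisedMultiples
import Algebra.Solver.Ring as RingSolver
open import Algebra.Solver.Ring.AlmostCommutativeRing using (fromCommutativeRing; _-Raw-AlmostCommutative⟶_)
open import Axiom.ExcludedMiddle using (ExcludedMiddle)
open import Data.Empty using (⊥; ⊥-elim)
open import Data.Fin.Base using (toℕ)
import Data.Integer.Base as ℤ
import Data.Integer.Properties as ℤₚ
open import Data.List.Base using (List; []; _∷_; applyUpTo; iterate; length; map)
open import Data.List.Properties using (length-iterate; length-map)
open import Data.List.Relation.Unary.All as All using (All; []; _∷_)
import Data.List.Relation.Unary.All.Properties as Allₚ
open import Data.List.Relation.Unary.Any as Any using (Any; here; there)
import Data.List.Relation.Unary.Any.Properties as Anyₚ
open import Data.Maybe.Base using (Maybe; just; nothing)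
open import Data.Nat.Base as ℕ using (ℕ; zero; suc; _∸_)
import Data.Nat.Properties as ℕₚ
open import Data.Product.Base using (∃-syntax; _×_; _,_; proj₁; proj₂)
import Data.Rational.Base as ℚ
open import Data.Sum.Base using (_⊎_; inj₁; inj₂)
open import Data.Vec.Base using (Vec; []; _∷_)
open import Data.Vec.Properties using (∷-injective)
open import Function.Base using (_∘_)
import Relation.Binary.Reasoning.Setoid as SetoidReasoning
open import Relation.Binary.PropositionalEquality.Core as ≡ using (_≡_)
open import Relation.Binary.Structures using (IsTotalOrder)
open import Relation.Nullary.Decidable.Core using (yes; no)
open import Relation.Nullary.Negation.Core using (¬_; contradiction)
open import Relation.Unary using (Pred)
open import Defs

-- Neither `ℂ(X)` nor a minimal polynomial of `G` is constructed. The algebra takes place in the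
-- domain of power series, with the polynomials as a subring, and a fraction appears only as a
-- nonzero polynomial multiplier. Linear dependence is therefore fraction-free elimination, which
-- has to certify at each step that some coefficient stays nonzero; otherwise a relation could
-- degenerate to `0 = 0`. Closure of the finite extension under `θ` costs a division by the
-- `Y`-derivative of an annihilating polynomial, taken at `G`. Characteristic zero provides an
-- annihilating polynomial for which this value is nonzero. The quotient stays in the extension
-- because every nonzero element of it has a multiple, by another of its elements, that is a nonzero
-- polynomial.

-- Normalisation of ring expressions with integer coefficients.

module IntegerSolver (R : CommutativeRing 0ℓ 0ℓ) where
  open CommutativeRing R
  open RingProperties ring
  open OptimisedMultiples semiring renaming (_×_ to _·_)
  open SetoidReasoning setoid

  private
    ⟦_⟧ℤ : ℤ.ℤ → Carrier
    ⟦ ℤ.+ n ⟧ℤ      = n · 1#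
    ⟦ ℤ.-[1+ n ] ⟧ℤ = - (suc n · 1#)

    [x+y]-[x+z] : ∀ x y z → (x + y) - (x + z) ≈ y - z
    [x+y]-[x+z] x y z = begin
      (x + y) - (x + z)       ≈⟨ +-cong (+-comm x y) (sym (-‿+-comm x z)) ⟩
      (y + x) + (- x + - z)   ≈⟨ +-assoc y x _ ⟩
      y + (x + (- x + - z))   ≈⟨ +-congˡ (+-assoc x (- x) (- z)) ⟨
      y + ((x - x) + - z)     ≈⟨ +-congˡ (+-congʳ (-‿inverseʳ x)) ⟩
      y + (0# + - z)          ≈⟨ +-congˡ (+-identityˡ (- z)) ⟩
      y - z                   ∎

    ⊖-homo : ∀ m n → ⟦ m ℤ.⊖ n ⟧ℤ ≈ m · 1# - n · 1#
    ⊖-homo m zero = sym (trans (+-congˡ -0#≈0#) (+-identityʳ _))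
    ⊖-homo zero (suc n) = sym (+-identityˡ _)
    ⊖-homo (suc m) (suc n) = begin
      ⟦ suc m ℤ.⊖ suc n ⟧ℤ                 ≡⟨ ≡.cong ⟦_⟧ℤ (ℤₚ.[1+m]⊖[1+n]≡m⊖n m n) ⟩
      ⟦ m ℤ.⊖ n ⟧ℤ                         ≈⟨ ⊖-homo m n ⟩
      m · 1# - n · 1#                      ≈⟨ [x+y]-[x+z] 1# _ _ ⟨
      (1# + m · 1#) - (1# + n · 1#)        ≈⟨ +-cong (×-homo-+ 1# 1 m) (-‿cong (×-homo-+ 1# 1 n)) ⟨
      suc m · 1# - suc n · 1#              ∎

    +-homo : ∀ i j → ⟦ i ℤ.+ j ⟧ℤ ≈ ⟦ i ⟧ℤ + ⟦ j ⟧ℤ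
    +-homo (ℤ.+ m)      (ℤ.+ n)      = ×-homo-+ 1# m n
    +-homo (ℤ.+ m)      ℤ.-[1+ n ]   = ⊖-homo m (suc n)
    +-homo ℤ.-[1+ m ]   (ℤ.+ n)      = trans (⊖-homo n (suc m)) (+-comm _ _)
    +-homo ℤ.-[1+ m ]   ℤ.-[1+ n ]   = begin
      - (suc (suc (m ℕ.+ n)) · 1#)       ≡⟨ ≡.cong (λ k → - (k · 1#)) (ℕₚ.+-suc (suc m) n) ⟨
      - ((suc m ℕ.+ suc n) · 1#)         ≈⟨ -‿cong (×-homo-+ 1# (suc m) (suc n)) ⟩
      - (suc m · 1# + suc n · 1#)        ≈⟨ -‿+-comm _ _ ⟨
      - (suc m · 1#) - suc n · 1#        ∎

    -‿homo : ∀ i → ⟦ ℤ.- i ⟧ℤ ≈ - ⟦ i ⟧ℤ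
    -‿homo (ℤ.+ zero)   = sym -0#≈0#
    -‿homo (ℤ.+ suc n)  = refl
    -‿homo ℤ.-[1+ n ]   = sym (-‿involutive _)

    *-homo-+ : ∀ m j → ⟦ ℤ.+ m ℤ.* j ⟧ℤ ≈ m · 1# * ⟦ j ⟧ℤ
    *-homo-+ m (ℤ.+ n) = begin
      ⟦ ℤ.+ m ℤ.* ℤ.+ n ⟧ℤ    ≡⟨ ≡.cong ⟦_⟧ℤ (ℤₚ.pos-* m n) ⟨
      (m ℕ.* n) · 1#          ≈⟨ ×1-homo-* m n ⟩
      m · 1# * n · 1#         ∎
    *-homo-+ m ℤ.-[1+ n ] = begin
      ⟦ ℤ.+ m ℤ.* ℤ.-[1+ n ] ⟧ℤ         ≡⟨ ≡.cong ⟦_⟧ℤ (ℤₚ.neg-distribʳ-* (ℤ.+ m) (ℤ.+ suc n)) ⟨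
      ⟦ ℤ.- (ℤ.+ m ℤ.* ℤ.+ suc n) ⟧ℤ    ≈⟨ -‿homo (ℤ.+ m ℤ.* ℤ.+ suc n) ⟩
      - ⟦ ℤ.+ m ℤ.* ℤ.+ suc n ⟧ℤ        ≈⟨ -‿cong (*-homo-+ m (ℤ.+ suc n)) ⟩
      - (m · 1# * suc n · 1#)           ≈⟨ -‿distribʳ-* _ _ ⟩
      m · 1# * - (suc n · 1#)           ∎

    *-homo : ∀ i j → ⟦ i ℤ.* j ⟧ℤ ≈ ⟦ i ⟧ℤ * ⟦ j ⟧ℤ
    *-homo (ℤ.+ m)    j = *-homo-+ m j
    *-homo ℤ.-[1+ m ] j = begin
      ⟦ ℤ.-[1+ m ] ℤ.* j ⟧ℤ          ≡⟨ ≡.cong ⟦_⟧ℤ (ℤₚ.neg-distribˡ-* (ℤ.+ suc m) j) ⟨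
      ⟦ ℤ.- (ℤ.+ suc m ℤ.* j) ⟧ℤ     ≈⟨ -‿homo (ℤ.+ suc m ℤ.* j) ⟩
      - ⟦ ℤ.+ suc m ℤ.* j ⟧ℤ         ≈⟨ -‿cong (*-homo-+ (suc m) j) ⟩
      - (suc m · 1# * ⟦ j ⟧ℤ)        ≈⟨ -‿distribˡ-* _ _ ⟩
      - (suc m · 1#) * ⟦ j ⟧ℤ        ∎

    morphism : ℤ.+-*-rawRing -Raw-AlmostCommutative⟶ fromCommutativeRing R
    morphism = record
      { ⟦_⟧ = ⟦_⟧ℤ ; +-homo = +-homo ; *-homo = *-homo ; -‿homo = -‿homo
      ; 0-homo = refl ; 1-homo = refl }

    _≟ℤ_ : ∀ i j → Maybe (⟦ i ⟧ℤ ≈ ⟦ j ⟧ℤ)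
    i ≟ℤ j with i ℤₚ.≟ j
    ... | yes ≡.refl = just refl
    ... | no _       = nothing

  open RingSolver _ _ morphism _≟ℤ_ public using (solve; _:=_; _:+_; _:*_; _:-_; :-_; con)

-- Domains of characteristic zero, subrings and derivations.

module _ (R : CommutativeRing 0ℓ 0ℓ) where
  open CommutativeRing R
  open SemiringMultiples semiring using () renaming (_×_ to _·_)

  record IsCharZeroDomain : Set where
    field
      noZeroDivisors : ∀ {x y} → x * y ≈ 0# → x ≈ 0# ⊎ y ≈ 0#
      charZero       : ∀ n → suc n · 1# ≉ 0#

    1≉0 : 1# ≉ 0#
    1≉0 1≈0 = charZero 0 (trans (+-identityʳ 1#) 1≈0)

    *-≉0 : ∀ {x y} → x ≉ 0# → y ≉ 0# → x * y ≉ 0#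
    *-≉0 x≉0 y≉0 xy≈0 with noZeroDivisors xy≈0
    ... | inj₁ x≈0 = x≉0 x≈0
    ... | inj₂ y≈0 = y≉0 y≈0

    *-cancel-≉0 : ∀ {x y} → x ≉ 0# → x * y ≈ 0# → y ≈ 0#
    *-cancel-≉0 x≉0 xy≈0 with noZeroDivisors xy≈0
    ... | inj₁ x≈0 = contradiction x≈0 x≉0
    ... | inj₂ y≈0 = y≈0

  record IsSubring (S : Pred Carrier 0ℓ) : Set where
    field
      resp      : ∀ {x y} → x ≈ y → S x → S y
      0-closed  : S 0#
      1-closed  : S 1#
      +-closed  : ∀ {x y} → S x → S y → S (x + y)
      *-closed  : ∀ {x y} → S x → S y → S (x * y)
      -‿closed  : ∀ {x} → S x → S (- x)

  record IsDerivation (∂ : Carrier → Carrier) : Set where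
    field
      ∂-cong  : ∀ {x y} → x ≈ y → ∂ x ≈ ∂ y
      ∂-+     : ∀ x y → ∂ (x + y) ≈ ∂ x + ∂ y
      leibniz : ∀ x y → ∂ (x * y) ≈ ∂ x * y + x * ∂ y

module _ (em : ExcludedMiddle 0ℓ) (R : CommutativeRing 0ℓ 0ℓ) where
  open CommutativeRing R
  open Algebraicity rawRing using (eval)
  open IntegerSolver R

  eval-trivial : ∀ ks x → ¬ Any (_≉ 0#) ks → eval ks x ≈ 0#
  eval-trivial []       x _  = refl
  eval-trivial (k ∷ ks) x ¬a with em {k ≈ 0#}
  ... | no k≉0  = contradiction (here k≉0) ¬a
  ... | yes k≈0 = trans (+-cong k≈0 (*-congˡ (eval-trivial ks x (¬a ∘ there))))
                    (solve 1 (λ x → con ℤ.0ℤ :+ x :* con ℤ.0ℤ := con ℤ.0ℤ) refl x)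

-- Fraction-free linear algebra over a subring of a domain.

module LinearDependence
  (em : ExcludedMiddle 0ℓ)
  (R : CommutativeRing 0ℓ 0ℓ)
  (isDomain : IsCharZeroDomain R)
  (S : Pred (CommutativeRing.Carrier R) 0ℓ) (isSubring : IsSubring R S)
  where
  open CommutativeRing R
  open IsCharZeroDomain isDomain
  open IsSubring isSubring
  open RingProperties ring using (-1*x≈-x)
  open IntegerSolver R
  open SetoidReasoning setoid

  Span : List Carrier → Pred Carrier 0ℓ
  Span []       y = y ≈ 0#
  Span (v ∷ vs) y = ∃[ c ] ∃[ r ] (S c × Span vs r × y ≈ c * v + r)

  -- The position of a nonzero coefficient is recorded along the list, and the value `y` stays
  -- arbitrary, so that relations (the case `y = 0#`) can be built and transported by recursion on
  -- the list.
  NontrivialSpan : List Carrier → Pred Carrier 0ℓ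
  NontrivialSpan []       y = ⊥
  NontrivialSpan (v ∷ vs) y =
    ∃[ c ] ∃[ r ] (S c × ((c ≉ 0# × Span vs r) ⊎ NontrivialSpan vs r) × y ≈ c * v + r)

  span-resp : ∀ vs {y z} → y ≈ z → Span vs y → Span vs z
  span-resp []       y≈z y≈0                      = trans (sym y≈z) y≈0
  span-resp (v ∷ vs) y≈z (c , r , Sc , sr , eq) = c , r , Sc , sr , trans (sym y≈z) eq

  span-0 : ∀ vs → Span vs 0#
  span-0 []       = refl
  span-0 (v ∷ vs) = 0# , 0# , 0-closed , span-0 vs ,
    solve 1 (λ v → con ℤ.0ℤ := con ℤ.0ℤ :* v :+ con ℤ.0ℤ) refl v

  span-+ : ∀ vs {y z} → Span vs y → Span vs z → Span vs (y + z)
  span-+ [] y≈0 z≈0 = trans (+-cong y≈0 z≈0) (+-identityˡ 0#)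
  span-+ (v ∷ vs) (c , r , Sc , sr , eq) (c′ , r′ , Sc′ , sr′ , eq′) =
    c + c′ , r + r′ , +-closed Sc Sc′ , span-+ vs sr sr′ ,
    trans (+-cong eq eq′)
      (solve 5 (λ c r c′ r′ v → (c :* v :+ r) :+ (c′ :* v :+ r′) := (c :+ c′) :* v :+ (r :+ r′))
        refl c r c′ r′ v)

  span-* : ∀ vs {s y} → S s → Span vs y → Span vs (s * y)
  span-* [] {s} Ss y≈0 = trans (*-congˡ y≈0) (zeroʳ s)
  span-* (v ∷ vs) {s} Ss (c , r , Sc , sr , eq) =
    s * c , s * r , *-closed Ss Sc , span-* vs Ss sr ,
    trans (*-congˡ eq)
      (solve 4 (λ s c r v → s :* (c :* v :+ r) := (s :* c) :* v :+ s :* r) refl s c r v)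

  span-neg : ∀ vs {y} → Span vs y → Span vs (- y)
  span-neg vs sy = span-resp vs (-1*x≈-x _) (span-* vs (-‿closed 1-closed) sy)

  nontrivial⇒span : ∀ vs {y} → NontrivialSpan vs y → Span vs y
  nontrivial⇒span (v ∷ vs) (c , r , Sc , inj₁ (_ , sr) , eq) = c , r , Sc , sr , eq
  nontrivial⇒span (v ∷ vs) (c , r , Sc , inj₂ nr , eq)       = c , r , Sc , nontrivial⇒span vs nr , eq

  span⇒nontrivial : ∀ vs {y} → Span vs y → y ≈ 0# ⊎ NontrivialSpan vs y
  span⇒nontrivial [] y≈0 = inj₁ y≈0
  span⇒nontrivial (v ∷ vs) (c , r , Sc , sr , eq) with span⇒nontrivial vs sr | em {c ≈ 0#}
  ... | inj₂ nr  | _       = inj₂ (c , r , Sc , inj₂ nr , eq)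
  ... | inj₁ r≈0 | no c≉0  = inj₂ (c , r , Sc , inj₁ (c≉0 , sr) , eq)
  ... | inj₁ r≈0 | yes c≈0 = inj₁ (begin
    _           ≈⟨ eq ⟩
    c * v + r   ≈⟨ +-cong (*-congʳ c≈0) r≈0 ⟩
    0# * v + 0# ≈⟨ solve 1 (λ v → con ℤ.0ℤ :* v :+ con ℤ.0ℤ := con ℤ.0ℤ) refl v ⟩
    0#          ∎)

  private
    factor : ∀ {y c u v r r′} → y ≈ c * (u * v) + r → r ≈ u * r′ → y ≈ u * (c * v + r′)
    factor {y} {c} {u} {v} {r} {r′} eq eq′ = begin
      y                     ≈⟨ eq ⟩
      c * (u * v) + r       ≈⟨ +-congˡ eq′ ⟩
      c * (u * v) + u * r′  ≈⟨ solve 4 (λ c u v r → c :* (u :* v) :+ u :* r := u :* (c :* v :+ r)) refl c u v r′ ⟩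
      u * (c * v + r′)      ∎

  span-map⁻ : ∀ u vs {y} → Span (map (u *_) vs) y → ∃[ r ] (Span vs r × y ≈ u * r)
  span-map⁻ u []       y≈0 = 0# , refl , trans y≈0 (sym (zeroʳ u))
  span-map⁻ u (v ∷ vs) (c , r , Sc , sr , eq) with span-map⁻ u vs sr
  ... | r′ , sr′ , eq′ = c * v + r′ , (c , r′ , Sc , sr′ , refl) , factor eq eq′

  span-map⁺ : ∀ u vs {y} → Span vs y → Span (map (u *_) vs) (u * y)
  span-map⁺ u []       y≈0 = trans (*-congˡ y≈0) (zeroʳ u)
  span-map⁺ u (v ∷ vs) (c , r , Sc , sr , eq) = c , u * r , Sc , span-map⁺ u vs sr ,
    trans (*-congˡ eq)
      (solve 4 (λ c u v r → u :* (c :* v :+ r) := c :* (u :* v) :+ u :* r) refl c u v r)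

  nontrivial-map⁻ : ∀ u vs {y} → NontrivialSpan (map (u *_) vs) y →
                    ∃[ r ] (NontrivialSpan vs r × y ≈ u * r)
  nontrivial-map⁻ u (v ∷ vs) (c , r , Sc , inj₁ (c≉0 , sr) , eq) with span-map⁻ u vs sr
  ... | r′ , sr′ , eq′ = c * v + r′ , (c , r′ , Sc , inj₁ (c≉0 , sr′) , refl) , factor eq eq′
  nontrivial-map⁻ u (v ∷ vs) (c , r , Sc , inj₂ nr , eq) with nontrivial-map⁻ u vs nr
  ... | r′ , nr′ , eq′ = c * v + r′ , (c , r′ , Sc , inj₂ nr′ , refl) , factor eq eq′

  -- Inclusion of spans alone would not transport a linear relation, since all coefficients might
  -- cancel on substitution; the second component excludes this.
  _⊴_ : List Carrier → List Carrier → Set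
  vs ⊴ ws = (∀ {y} → Span vs y → Span ws y) × (∀ {y} → NontrivialSpan vs y → NontrivialSpan ws y)

  private
    -- A round of Gaussian elimination without division: each `u` becomes `s * u - s′ * v`, in which
    -- `b` cancels. The last component places the nonzero coefficient on the old vectors `u`, where
    -- it is `k * s`; the coefficient of `v` collects several terms and may vanish, so the induction
    -- cannot rely on it.
    pivot : ∀ b bs {v s r} → S s → s ≉ 0# → Span bs r → v ≈ s * b + r →
            ∀ vs → All (Span (b ∷ bs)) vs →
            ∃[ vs′ ] (length vs′ ≡ length vs × All (Span bs) vs′ × vs′ ⊴ (v ∷ vs)
              × (∀ {y} → NontrivialSpan vs′ y →
                   ∃[ c ] ∃[ q ] (S c × NontrivialSpan vs q × y ≈ c * v + q)))
    pivot b bs {v} Ss s≉0 sr eq [] [] = [] , ≡.refl , [] ,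
      ((λ y≈0 → span-resp (v ∷ []) (sym y≈0) (span-0 (v ∷ []))) , λ ()) , λ ()
    pivot b bs {v} {s} {r} Ss s≉0 sr eq (u ∷ us) ((s′ , r′ , Ss′ , sr′ , eq′) ∷ all)
      with pivot b bs Ss s≉0 sr eq us all
    ... | us′ , len , all′ , (sp , _) , nt =
      (s * u - s′ * v) ∷ us′ , ≡.cong suc len , head∈ ∷ all′ ,
      (sp′ , λ n → let (c , q , Sc , nq , e) = nt′ n in c , q , Sc , inj₂ nq , e) , nt′
      where
      head∈ : Span bs (s * u - s′ * v)
      head∈ = span-resp bs (begin
        s * r′ - s′ * r ≈⟨ solve 5 (λ s s′ r r′ b → s :* r′ :- s′ :* r := s :* (s′ :* b :+ r′) :- s′ :* (s :* b :+ r)) refl s s′ r r′ b ⟩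
        s * (s′ * b + r′) - s′ * (s * b + r) ≈⟨ +-cong (*-congˡ eq′) (-‿cong (*-congˡ eq)) ⟨
        s * u - s′ * v ∎)
        (span-+ bs (span-* bs Ss sr′) (span-neg bs (span-* bs Ss′ sr)))

      rearrange : ∀ {y k c ρ q} → y ≈ k * (s * u - s′ * v) + ρ → ρ ≈ c * v + q →
                  y ≈ (c - k * s′) * v + (k * s * u + q)
      rearrange {y} {k} {c} {ρ} {q} e e′ = begin
        y ≈⟨ e ⟩
        k * (s * u - s′ * v) + ρ ≈⟨ +-congˡ e′ ⟩
        k * (s * u - s′ * v) + (c * v + q)
          ≈⟨ solve 7 (λ k s u s′ v c q → k :* (s :* u :- s′ :* v) :+ (c :* v :+ q) := (c :- k :* s′) :* v :+ (k :* s :* u :+ q)) refl k s u s′ v c q ⟩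
        (c - k * s′) * v + (k * s * u + q) ∎

      S-coeff : ∀ {c k} → S c → S k → S (c - k * s′)
      S-coeff Sc Sk = +-closed Sc (-‿closed (*-closed Sk Ss′))

      sp′ : ∀ {y} → Span ((s * u - s′ * v) ∷ us′) y → Span (v ∷ u ∷ us) y
      sp′ (k , ρ , Sk , sρ , e) with sp sρ
      ... | c , q , Sc , sq , e′ = c - k * s′ , k * s * u + q , S-coeff Sc Sk ,
        (k * s , q , *-closed Sk Ss , sq , refl) , rearrange e e′

      nt′ : ∀ {y} → NontrivialSpan ((s * u - s′ * v) ∷ us′) y →
            ∃[ c ] ∃[ q ] (S c × NontrivialSpan (u ∷ us) q × y ≈ c * v + q)
      nt′ (k , ρ , Sk , inj₁ (k≉0 , sρ) , e) with sp sρ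
      ... | c , q , Sc , sq , e′ = c - k * s′ , k * s * u + q , S-coeff Sc Sk ,
        (k * s , q , *-closed Sk Ss , inj₁ (*-≉0 k≉0 s≉0 , sq) , refl) , rearrange e e′
      nt′ (k , ρ , Sk , inj₂ nρ , e) with nt nρ
      ... | c , q , Sc , nq , e′ = c - k * s′ , k * s * u + q , S-coeff Sc Sk ,
        (k * s , q , *-closed Sk Ss , inj₂ nq , refl) , rearrange e e′

    -- A vector with coefficient zero at `b` already lies in the smaller span and is kept while the
    -- search for a pivot goes on. Exactly one vector is lost: the pivot, or the last vector if
    -- there is no pivot.
    eliminate : ∀ b bs v vs → All (Span (b ∷ bs)) (v ∷ vs) →
                ∃[ vs′ ] (length vs′ ≡ length vs × All (Span bs) vs′ × vs′ ⊴ (v ∷ vs))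
    eliminate b bs v vs ((s , r , Ss , sr , eq) ∷ all) with em {s ≈ 0#}
    ... | no s≉0 with pivot b bs Ss s≉0 sr eq vs all
    ...   | vs′ , len , all′ , v⊴ , _ = vs′ , len , all′ , v⊴
    eliminate b bs v [] _ | yes _ = [] , ≡.refl , [] ,
      (λ y≈0 → span-resp (v ∷ []) (sym y≈0) (span-0 (v ∷ []))) , λ ()
    eliminate b bs v (u ∷ us) ((s , r , Ss , sr , eq) ∷ all) | yes s≈0 with eliminate b bs u us all
    ... | us′ , len , all′ , (sp , nt) = v ∷ us′ , ≡.cong suc len , v∈ ∷ all′ ,
      (λ { (c , q , Sc , sq , e) → c , q , Sc , sp sq , e }) ,
      (λ { (c , q , Sc , inj₁ (c≉0 , sq) , e) → c , q , Sc , inj₁ (c≉0 , sp sq) , e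
         ; (c , q , Sc , inj₂ nq , e) → c , q , Sc , inj₂ (nt nq) , e })
      where
      v∈ : Span bs v
      v∈ = span-resp bs (begin
        r          ≈⟨ solve 2 (λ r b → r := con ℤ.0ℤ :* b :+ r) refl r b ⟩
        0# * b + r ≈⟨ +-congʳ (*-congʳ s≈0) ⟨
        s * b + r  ≈⟨ eq ⟨
        v          ∎) sr

  -- Elimination shortens both lists by one, so a vector remains when the generators are used up; it
  -- is zero, and `1# * v` is the relation.
  dependent : ∀ bs vs → length bs ℕ.< length vs → All (Span bs) vs → NontrivialSpan vs 0#
  dependent [] (v ∷ vs) _ (v≈0 ∷ _) = 1# , 0# , 1-closed , inj₁ (1≉0 , span-0 vs) ,
    sym (trans (+-congʳ (*-congˡ v≈0)) (solve 0 (con ℤ.1ℤ :* con ℤ.0ℤ :+ con ℤ.0ℤ := con ℤ.0ℤ) refl))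
  dependent (b ∷ bs) (v ∷ vs) (ℕ.s≤s bs<vs) all with eliminate b bs v vs all
  ... | vs′ , len , all′ , (_ , nt) =
    nt (dependent bs vs′ (≡.subst (length bs ℕ.<_) (≡.sym len) bs<vs) all′)

-- Algebraic elements: powers, leading terms and separability.

module AlgebraicElement
  (em : ExcludedMiddle 0ℓ)
  (R : CommutativeRing 0ℓ 0ℓ)
  (isDomain : IsCharZeroDomain R)
  (S : Pred (CommutativeRing.Carrier R) 0ℓ) (isSubring : IsSubring R S)
  (g : CommutativeRing.Carrier R)
  where
  open CommutativeRing R hiding (zero)
  open IsCharZeroDomain isDomain
  open IsSubring isSubring
  open LinearDependence em R isDomain S isSubring
  open Algebraicity rawRing using (eval; AlgebraicOver)
  open SemiringMultiples semiring using () renaming (_×_ to _·_)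
  open SemiringPowers semiring using (_^_)
  open RingProperties ring using (x+x≈x⇒x≈0)
  open IntegerSolver R
  open SetoidReasoning setoid

  -- Built with `map (u *_)` so that a combination takes the Horner form `c + u * r` of `eval`.
  powers : Carrier → ℕ → List Carrier
  powers u zero    = []
  powers u (suc n) = 1# ∷ map (u *_) (powers u n)

  length-powers : ∀ u n → length (powers u n) ≡ n
  length-powers u zero    = ≡.refl
  length-powers u (suc n) = ≡.cong suc (≡.trans (length-map (u *_) (powers u n)) (length-powers u n))

  span-powers-1 : ∀ u n → Span (powers u (suc n)) 1#
  span-powers-1 u n = 1# , 0# , 1-closed , span-0 (map (u *_) (powers u n)) ,
    solve 0 (con ℤ.1ℤ := con ℤ.1ℤ :* con ℤ.1ℤ :+ con ℤ.0ℤ) refl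

  span-powers-* : ∀ u n {y} → Span (powers u n) y → Span (powers u (suc n)) (u * y)
  span-powers-* u n {y} sy = 0# , u * y , 0-closed , span-map⁺ u (powers u n) sy ,
    solve 1 (λ x → x := con ℤ.0ℤ :* con ℤ.1ℤ :+ x) refl (u * y)

  span-powers-cons : ∀ u n {c y} → S c → Span (powers u n) y → Span (powers u (suc n)) (c + u * y)
  span-powers-cons u n {c} {y} Sc sy = c , u * y , Sc , span-map⁺ u (powers u n) sy ,
    +-congʳ (sym (*-identityʳ c))

  span-powers-uncons : ∀ u n {y} → Span (powers u (suc n)) y →
                       ∃[ c ] ∃[ r ] (S c × Span (powers u n) r × y ≈ c + u * r)
  span-powers-uncons u n (c , r , Sc , sr , eq) with span-map⁻ u (powers u n) sr
  ... | r′ , sr′ , eq′ = c , r′ , Sc , sr′ , trans eq (+-cong (*-identityʳ c) eq′)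

  nontrivial-powers-uncons : ∀ u n {y} → NontrivialSpan (powers u (suc n)) y →
    ∃[ c ] ∃[ r ] (S c × ((c ≉ 0# × Span (powers u n) r) ⊎ NontrivialSpan (powers u n) r) × y ≈ c + u * r)
  nontrivial-powers-uncons u n (c , r , Sc , inj₁ (c≉0 , sr) , eq) with span-map⁻ u (powers u n) sr
  ... | r′ , sr′ , eq′ = c , r′ , Sc , inj₁ (c≉0 , sr′) , trans eq (+-cong (*-identityʳ c) eq′)
  nontrivial-powers-uncons u n (c , r , Sc , inj₂ nr , eq) with nontrivial-map⁻ u (powers u n) nr
  ... | r′ , nr′ , eq′ = c , r′ , Sc , inj₂ nr′ , trans eq (+-cong (*-identityʳ c) eq′)

  private
    step-last : ∀ {u y c r r′ a p} → y ≈ c + u * r → r ≈ r′ + a * p → y ≈ (c + u * r′) + a * (u * p)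
    step-last {u} {y} {c} {r} {r′} {a} {p} e e′ = trans e (trans (+-congˡ (*-congˡ e′))
      (solve 5 (λ u c r a p → c :+ u :* (r :+ a :* p) := (c :+ u :* r) :+ a :* (u :* p)) refl u c r′ a p))

    base-last : ∀ {u y c r} → y ≈ c + u * r → r ≈ 0# → y ≈ 0# + c * 1#
    base-last {u} {y} {c} {r} e r≈0 = trans e (trans (+-congˡ (*-congˡ r≈0))
      (solve 2 (λ u c → c :+ u :* con ℤ.0ℤ := con ℤ.0ℤ :+ c :* con ℤ.1ℤ) refl u c))

  span-powers-last : ∀ u n {y} → Span (powers u (suc n)) y →
                     ∃[ c ] ∃[ r ] (S c × Span (powers u n) r × y ≈ r + c * (u ^ n))
  span-powers-last u zero sy with span-powers-uncons u zero sy
  ... | c , r , Sc , r≈0 , eq = c , 0# , Sc , refl , base-last eq r≈0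
  span-powers-last u (suc n) sy with span-powers-uncons u (suc n) sy
  ... | c , r , Sc , sr , eq with span-powers-last u n sr
  ...   | a , r′ , Sa , sr′ , eq′ =
    a , c + u * r′ , Sa , span-powers-cons u n Sc sr′ , step-last eq eq′

  -- The top entries of a coefficient list may be zero. Trimming them produces the term
  -- `a * (g ^ m)` with `a ≉ 0#` that `FiniteExtension` rewrites in lower powers.
  leadingTerm : ∀ u n {y} → NontrivialSpan (powers u n) y →
                ∃[ m ] ∃[ a ] ∃[ r ] (S a × a ≉ 0# × Span (powers u m) r × y ≈ r + a * (u ^ m))
  leadingTerm u (suc n) {y} ny with nontrivial-powers-uncons u n ny
  ... | c , r , Sc , alt , eq = cases alt
    where
    Goal = ∃[ m ] ∃[ a ] ∃[ r ] (S a × a ≉ 0# × Span (powers u m) r × y ≈ r + a * (u ^ m))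

    cases′ : NontrivialSpan (powers u n) r → Goal
    cases′ nr with leadingTerm u n nr
    ... | m , a , r′ , Sa , a≉0 , sr′ , eq′ =
      suc m , a , c + u * r′ , Sa , a≉0 , span-powers-cons u m Sc sr′ , step-last eq eq′

    cases : (c ≉ 0# × Span (powers u n) r) ⊎ NontrivialSpan (powers u n) r → Goal
    cases (inj₂ nr) = cases′ nr
    cases (inj₁ (c≉0 , sr)) with span⇒nontrivial (powers u n) sr
    ... | inj₁ r≈0 = 0 , c , 0# , Sc , c≉0 , refl , base-last eq r≈0
    ... | inj₂ nr  = cases′ nr

  eval-span : ∀ {ks} u → All S ks → Span (powers u (length ks)) (eval ks u)
  eval-span u []                  = refl
  eval-span {k ∷ ks} u (Sk ∷ Sks) = span-powers-cons u (length ks) Sk (eval-span u Sks)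

  eval-nontrivial : ∀ {ks} u → All S ks → Any (_≉ 0#) ks → NontrivialSpan (powers u (length ks)) (eval ks u)
  eval-nontrivial {k ∷ ks} u (Sk ∷ Sks) (here k≉0) =
    k , u * eval ks u , Sk , inj₁ (k≉0 , span-map⁺ u (powers u (length ks)) (eval-span u Sks)) ,
    +-congʳ (sym (*-identityʳ k))
  eval-nontrivial {k ∷ ks} u (Sk ∷ Sks) (there any) =
    k , u * eval ks u , Sk , inj₂ (nontrivial-map⁺ (powers u (length ks)) (eval-nontrivial u Sks any)) ,
    +-congʳ (sym (*-identityʳ k))
    where
    nontrivial-map⁺ : ∀ vs {y} → NontrivialSpan vs y → NontrivialSpan (map (u *_) vs) (u * y)
    nontrivial-map⁺ (v ∷ vs) (c , r , Sc , alt , eq) = c , u * r , Sc , lift alt ,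
      trans (*-congˡ eq)
        (solve 4 (λ c u v r → u :* (c :* v :+ r) := c :* (u :* v) :+ u :* r) refl c u v r)
      where
      lift : (c ≉ 0# × Span vs r) ⊎ NontrivialSpan vs r →
             (c ≉ 0# × Span (map (u *_) vs) (u * r)) ⊎ NontrivialSpan (map (u *_) vs) (u * r)
      lift (inj₁ (c≉0 , sr)) = inj₁ (c≉0 , span-map⁺ u vs sr)
      lift (inj₂ nr)         = inj₂ (nontrivial-map⁺ vs nr)

  -- The formal derivative of the polynomial `ks`, evaluated at `g`: the product rule applied to the
  -- Horner step `k + Y * p(Y)`.
  ∂Y : List Carrier → Carrier
  ∂Y []       = 0#
  ∂Y (k ∷ ks) = eval ks g + g * ∂Y ks

  private
    -- The coefficients of the derivative of `Y ^ (1 + n) * ks(Y)`, divided by `Y ^ n`. For `n = 0`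
    -- this is the derivative of `k ∷ ks`, whatever `k` is.
    scale : ℕ → List Carrier → List Carrier
    scale n []       = []
    scale n (k ∷ ks) = (suc n · 1#) * k ∷ scale (suc n) ks

    length-scale : ∀ n ks → length (scale n ks) ≡ length ks
    length-scale n []       = ≡.refl
    length-scale n (k ∷ ks) = ≡.cong suc (length-scale (suc n) ks)

    ·1-closed : ∀ n → S (n · 1#)
    ·1-closed zero    = 0-closed
    ·1-closed (suc n) = +-closed 1-closed (·1-closed n)

    scale-All : ∀ n {ks} → All S ks → All S (scale n ks)
    scale-All n []         = []
    scale-All n (Sk ∷ Sks) = *-closed (·1-closed (suc n)) Sk ∷ scale-All (suc n) Sks

    scale-Any : ∀ n {ks} → Any (_≉ 0#) ks → Any (_≉ 0#) (scale n ks)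
    scale-Any n (here k≉0)  = here (*-≉0 (charZero n) k≉0)
    scale-Any n (there any) = there (scale-Any (suc n) any)

    eval-scale : ∀ n ks → eval (scale n ks) g ≈ (suc n · 1#) * eval ks g + g * ∂Y ks
    eval-scale n []       = solve 2 (λ ν g → con ℤ.0ℤ := (con ℤ.1ℤ :+ ν) :* con ℤ.0ℤ :+ g :* con ℤ.0ℤ) refl (n · 1#) g
    eval-scale n (k ∷ ks) = trans (+-congˡ (*-congˡ (eval-scale (suc n) ks)))
      (solve 5 (λ ν k g e d → (con ℤ.1ℤ :+ ν) :* k :+ g :* ((con ℤ.1ℤ :+ (con ℤ.1ℤ :+ ν)) :* e :+ g :* d)
                           := (con ℤ.1ℤ :+ ν) :* (k :+ g :* e) :+ g :* (e :+ g :* d))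
        refl (n · 1#) k g (eval ks g) (∂Y ks))

  SeparablyAlgebraic : Set
  SeparablyAlgebraic = ∃[ ks ] (All S ks × Any (_≉ 0#) ks × eval ks g ≈ 0# × ∂Y ks ≉ 0#)

  -- As long as the formal derivative also vanishes at g, it is an
  -- annihilating polynomial of smaller degree.
  separable : AlgebraicOver S g → SeparablyAlgebraic
  separable (ks , Sks , any , eq) = go (length ks) ks ℕₚ.≤-refl Sks any eq
    where
    go : ∀ n ks → length ks ℕ.≤ n → All S ks → Any (_≉ 0#) ks → eval ks g ≈ 0# → SeparablyAlgebraic
    go (suc n) (k ∷ ks) (ℕ.s≤s len) Sks any eq with em {∂Y (k ∷ ks) ≈ 0#}
    ... | no ≉0 = k ∷ ks , Sks , any , eq , ≉0
    ... | yes ≈0 with em {Any (_≉ 0#) ks}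
    ...   | yes any′ = go n (scale 0 ks) (≡.subst (ℕ._≤ n) (≡.sym (length-scale 0 ks)) len)
              (scale-All 0 (All.tail Sks)) (scale-Any 0 any′) (begin
                eval (scale 0 ks) g                       ≈⟨ eval-scale 0 ks ⟩
                (1# + 0#) * eval ks g + g * ∂Y ks         ≈⟨ solve 2 (λ x y → (con ℤ.1ℤ :+ con ℤ.0ℤ) :* x :+ y := x :+ y) refl (eval ks g) (g * ∂Y ks) ⟩
                eval ks g + g * ∂Y ks                     ≈⟨ ≈0 ⟩
                0#                                        ∎)
    ...   | no ¬any = ⊥-elim (k≉0 any (begin
              k                  ≈⟨ solve 2 (λ k g → k := k :+ g :* con ℤ.0ℤ) refl k g ⟩
              k + g * 0#         ≈⟨ +-congˡ (*-congˡ (eval-trivial em R ks g ¬any)) ⟨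
              k + g * eval ks g  ≈⟨ eq ⟩
              0#                 ∎))
      where
      k≉0 : Any (_≉ 0#) (k ∷ ks) → k ≉ 0#
      k≉0 (here k≉0) = k≉0
      k≉0 (there a)  = contradiction a ¬any

  -- The finite extension generated by `g`, and its closure under division and derivations.

  module FiniteExtension
    (m : ℕ) (a : Carrier) (Sa : S a) (a≉0 : a ≉ 0#)
    (reduction : Span (powers g m) (a * (g ^ m)))
    where

    -- the elements of R in the Frac(S)-span of 1, g, …, gᵐ⁻¹
    V : Pred Carrier 0ℓ
    V y = ∃[ d ] (S d × d ≉ 0# × Span (powers g m) (d * y))

    V-resp : ∀ {y z} → y ≈ z → V y → V z
    V-resp y≈z (d , Sd , d≉0 , sp) = d , Sd , d≉0 , span-resp (powers g m) (*-congˡ y≈z) sp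

    V-÷S : ∀ {d y} → S d → d ≉ 0# → V (d * y) → V y
    V-÷S {d} {y} Sd d≉0 (e , Se , e≉0 , sp) =
      e * d , *-closed Se Sd , *-≉0 e≉0 d≉0 , span-resp (powers g m) (sym (*-assoc e d y)) sp

    V-*S : ∀ {s y} → S s → V y → V (s * y)
    V-*S {s} {y} Ss (d , Sd , d≉0 , sp) = d , Sd , d≉0 ,
      span-resp (powers g m) (solve 3 (λ s d y → s :* (d :* y) := d :* (s :* y)) refl s d y)
        (span-* (powers g m) Ss sp)

    V-+ : ∀ {y z} → V y → V z → V (y + z)
    V-+ {y} {z} (d , Sd , d≉0 , sp) (e , Se , e≉0 , sp′) =
      d * e , *-closed Sd Se , *-≉0 d≉0 e≉0 ,
      span-resp (powers g m) (solve 4 (λ d e y z → e :* (d :* y) :+ d :* (e :* z) := (d :* e) :* (y :+ z)) refl d e y z)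
        (span-+ (powers g m) (span-* (powers g m) Se sp) (span-* (powers g m) Sd sp′))

    V-neg : ∀ {y} → V y → V (- y)
    V-neg {y} vy = V-resp (solve 1 (λ y → (:- con ℤ.1ℤ) :* y := :- y) refl y) (V-*S (-‿closed 1-closed) vy)

    -- Multiplication by `a` makes the top power reducible, and `a` is then absorbed into the
    -- denominator.
    span-suc⊆V : ∀ {y} → Span (powers g (suc m)) y → V y
    span-suc⊆V {y} sp with span-powers-last g m sp
    ... | c , r , Sc , sr , eq = a , Sa , a≉0 ,
      span-resp (powers g m)
        (trans (solve 4 (λ a c r p → a :* r :+ c :* (a :* p) := a :* (r :+ c :* p)) refl a c r (g ^ m)) (*-congˡ (sym eq)))
        (span-+ (powers g m) (span-* (powers g m) Sa sr) (span-* (powers g m) Sc reduction))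

    V-1 : V 1#
    V-1 = span-suc⊆V (span-powers-1 g m)

    V-S : ∀ {s} → S s → V s
    V-S {s} Ss = V-resp (*-identityʳ s) (V-*S Ss V-1)

    V-*g : ∀ {y} → V y → V (g * y)
    V-*g {y} (d , Sd , d≉0 , sp) = V-÷S Sd d≉0
      (V-resp (solve 3 (λ g d y → g :* (d :* y) := d :* (g :* y)) refl g d y)
        (span-suc⊆V (span-powers-* g m sp)))

    V-*span : ∀ n {y z} → V y → Span (powers g n) z → V (y * z)
    V-*span zero {y} {z} vy z≈0 = V-resp (trans (sym (zeroʳ y)) (*-congˡ (sym z≈0))) (V-S 0-closed)
    V-*span (suc n) {y} {z} vy sz with span-powers-uncons g n sz
    ... | c , r , Sc , sr , eq = V-resp
      (trans (solve 4 (λ c y g r → c :* y :+ g :* (y :* r) := y :* (c :+ g :* r)) refl c y g r) (*-congˡ (sym eq)))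
      (V-+ (V-*S Sc vy) (V-*g (V-*span n vy sr)))

    V-* : ∀ {y z} → V y → V z → V (y * z)
    V-* {y} {z} vy (d , Sd , d≉0 , sp) = V-÷S Sd d≉0
      (V-resp (solve 3 (λ y d z → y :* (d :* z) := d :* (y :* z)) refl y d z) (V-*span m vy sp))

    V-g : V g
    V-g = V-resp (*-identityʳ g) (V-*g V-1)

    V-span : ∀ {u} n {y} → V u → Span (powers u n) y → V y
    V-span zero vu y≈0 = V-resp (sym y≈0) (V-S 0-closed)
    V-span {u} (suc n) vu sy with span-powers-uncons u n sy
    ... | c , r , Sc , sr , eq = V-resp (sym eq) (V-+ (V-S Sc) (V-* vu (V-span n vu sr)))

    -- Each vector is first multiplied by its denominator `d`. A coefficient `c` of `d * v` is the
    -- coefficient `c * d` of `v`, nonzero together with `c`.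
    V-dependent : ∀ vs → m ℕ.< length vs → All V vs → NontrivialSpan vs 0#
    V-dependent vs m<len all with clear vs all
      where
      clear : ∀ vs → All V vs → ∃[ vs′ ] (length vs′ ≡ length vs × All (Span (powers g m)) vs′ × vs′ ⊴ vs)
      clear [] [] = [] , ≡.refl , [] , (λ e → e) , λ ()
      clear (v ∷ vs) ((d , Sd , d≉0 , sp) ∷ all) with clear vs all
      ... | vs′ , len , all′ , (s⇒ , n⇒) = d * v ∷ vs′ , ≡.cong suc len , sp ∷ all′ ,
        (λ { (c , r , Sc , sr , eq) → c * d , r , *-closed Sc Sd , s⇒ sr , assoc eq }) ,
        (λ { (c , r , Sc , inj₁ (c≉0 , sr) , eq) → c * d , r , *-closed Sc Sd , inj₁ (*-≉0 c≉0 d≉0 , s⇒ sr) , assoc eq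
           ; (c , r , Sc , inj₂ nr , eq) → c * d , r , *-closed Sc Sd , inj₂ (n⇒ nr) , assoc eq })
        where
        assoc : ∀ {y c r} → y ≈ c * (d * v) + r → y ≈ c * d * v + r
        assoc {y} {c} eq = trans eq (+-congʳ (sym (*-assoc c d v)))
    ... | vs′ , len , all′ , (_ , n⇒) = n⇒ (dependent (powers g m) vs′
      (≡.subst₂ ℕ._<_ (≡.sym (length-powers g m)) (≡.sym len) m<len) all′)

    V-powers : ∀ {u} n → V u → All V (powers u n)
    V-powers zero    vu = []
    V-powers (suc n) vu = V-1 ∷ Allₚ.map⁺ (All.map (V-* vu) (V-powers n vu))

    -- The powers of u satisfy a linear relation; its lowest nonzero
    -- coefficient is then a multiple of u.
    V-denominator : ∀ {u} → V u → u ≉ 0# → ∃[ h ] ∃[ c ] (V h × S c × c ≉ 0# × u * h ≈ c)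
    V-denominator {u} vu u≉0 = go (suc m)
      (V-dependent (powers u (suc m)) (≡.subst (m ℕ.<_) (≡.sym (length-powers u (suc m))) ℕₚ.≤-refl)
        (V-powers (suc m) vu))
      where
      go : ∀ n → NontrivialSpan (powers u n) 0# → ∃[ h ] ∃[ c ] (V h × S c × c ≉ 0# × u * h ≈ c)
      go (suc n) nt with nontrivial-powers-uncons u n nt
      ... | c , r , Sc , alt , eq with em {c ≈ 0#}
      ...   | no c≉0 = - r , c , V-neg (V-span n vu (toSpan alt)) , Sc , c≉0 , (begin
                u * - r             ≈⟨ solve 3 (λ u r c → u :* (:- r) := c :- (c :+ u :* r)) refl u r c ⟩
                c - (c + u * r)     ≈⟨ +-congˡ (-‿cong eq) ⟨
                c - 0#              ≈⟨ solve 1 (λ c → c :- con ℤ.0ℤ := c) refl c ⟩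
                c                   ∎)
        where
        toSpan : (c ≉ 0# × Span (powers u n) r) ⊎ NontrivialSpan (powers u n) r → Span (powers u n) r
        toSpan (inj₁ (_ , sr)) = sr
        toSpan (inj₂ nr)       = nontrivial⇒span (powers u n) nr
      go (suc n) nt | c , r , Sc , inj₁ (c≉0 , _) , eq | yes c≈0 = contradiction c≈0 c≉0
      go (suc n) nt | c , r , Sc , inj₂ nr , eq | yes c≈0 =
        go n (nt-resp (powers u n) (*-cancel-≉0 u≉0 (begin
          u * r      ≈⟨ +-identityˡ _ ⟨
          0# + u * r ≈⟨ +-congʳ c≈0 ⟨
          c + u * r  ≈⟨ eq ⟨
          0#         ∎)) nr)
        where
        nt-resp : ∀ vs {y z} → y ≈ z → NontrivialSpan vs y → NontrivialSpan vs z
        nt-resp (v ∷ vs) y≈z (c , r , Sc , alt , eq) = c , r , Sc , alt , trans (sym y≈z) eq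

    -- From `u * h ≈ c`, the fraction `h / c` inverts `u`, so `y` is `h * (u * y)` divided by the
    -- element `c` of `S`.
    V-÷ : ∀ {u y} → V u → u ≉ 0# → V (u * y) → V y
    V-÷ {u} {y} vu u≉0 vuy =
      let h , c , vh , Sc , c≉0 , eq = V-denominator vu u≉0
      in V-÷S Sc c≉0 (V-resp (trans (solve 3 (λ h u y → h :* (u :* y) := (u :* h) :* y) refl h u y) (*-congʳ eq))
           (V-* vh vuy))

    module _ (∂ : Carrier → Carrier) (isDerivation : IsDerivation R ∂) (∂-closed : ∀ {s} → S s → S (∂ s)) where
      open IsDerivation isDerivation

      ∂-0 : ∂ 0# ≈ 0#
      ∂-0 = x+x≈x⇒x≈0 (∂ 0#) (trans (sym (∂-+ 0# 0#)) (∂-cong (+-identityˡ 0#)))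

      ∂-eval : ∀ ks → ∂ (eval ks g) ≈ eval (map ∂ ks) g + ∂Y ks * ∂ g
      ∂-eval [] = trans ∂-0 (solve 1 (λ x → con ℤ.0ℤ := con ℤ.0ℤ :+ con ℤ.0ℤ :* x) refl (∂ g))
      ∂-eval (k ∷ ks) = begin
        ∂ (k + g * eval ks g)                                   ≈⟨ ∂-+ _ _ ⟩
        ∂ k + ∂ (g * eval ks g)                                 ≈⟨ +-congˡ (leibniz _ _) ⟩
        ∂ k + (∂ g * eval ks g + g * ∂ (eval ks g))             ≈⟨ +-congˡ (+-congˡ (*-congˡ (∂-eval ks))) ⟩
        ∂ k + (∂ g * eval ks g + g * (eval (map ∂ ks) g + ∂Y ks * ∂ g))
          ≈⟨ solve 6 (λ k g′ e g e′ d → k :+ (g′ :* e :+ g :* (e′ :+ d :* g′)) := (k :+ g :* e′) :+ (e :+ g :* d) :* g′)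
               refl (∂ k) (∂ g) (eval ks g) g (eval (map ∂ ks) g) (∂Y ks) ⟩
        (∂ k + g * eval (map ∂ ks) g) + (eval ks g + g * ∂Y ks) * ∂ g ∎

      V-eval : ∀ {ks} → All S ks → V (eval ks g)
      V-eval []         = V-S 0-closed
      V-eval (Sk ∷ Sks) = V-+ (V-S Sk) (V-*g (V-eval Sks))

      V-∂Y : ∀ {ks} → All S ks → V (∂Y ks)
      V-∂Y []         = V-S 0-closed
      V-∂Y (Sk ∷ Sks) = V-+ (V-eval Sks) (V-*g (V-∂Y Sks))

      -- Differentiating `ks(g) = 0` gives `(∂ ks)(g) + ks′(g) * ∂ g = 0`. Both polynomial values
      -- lie in `V`, and `ks′(g)` is nonzero by separability, so `V-÷` solves for `∂ g`.
      V-∂g : SeparablyAlgebraic → V (∂ g)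
      V-∂g (ks , Sks , _ , eq , ≉0) = V-÷ (V-∂Y Sks) ≉0
        (V-resp (begin
          - eval (map ∂ ks) g                                        ≈⟨ +-identityˡ _ ⟨
          0# - eval (map ∂ ks) g                                     ≈⟨ +-congʳ (trans (∂-cong eq) ∂-0) ⟨
          ∂ (eval ks g) - eval (map ∂ ks) g                          ≈⟨ +-congʳ (∂-eval ks) ⟩
          (eval (map ∂ ks) g + ∂Y ks * ∂ g) - eval (map ∂ ks) g      ≈⟨ solve 2 (λ x y → (x :+ y) :- x := y) refl _ _ ⟩
          ∂Y ks * ∂ g                                                ∎)
          (V-neg (V-eval (Allₚ.map⁺ (All.map ∂-closed Sks)))))

      module _ (v∂g : V (∂ g)) where
        V-∂span : ∀ n {z} → Span (powers g n) z → V (∂ z)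
        V-∂span zero z≈0 = V-resp (sym (trans (∂-cong z≈0) ∂-0)) (V-S 0-closed)
        V-∂span (suc n) {z} sz with span-powers-uncons g n sz
        ... | c , r , Sc , sr , eq = V-resp
          (sym (trans (∂-cong eq) (trans (∂-+ _ _) (+-congˡ (leibniz g r)))))
          (V-+ (V-S (∂-closed Sc)) (V-+ (V-*span n v∂g sr) (V-*g (V-∂span n sr))))

        -- The Leibniz rule gives `d * ∂ y = ∂ (d * y) - ∂ d * y`, where `d * y` is a combination of
        -- powers of `g` and is covered by `V-∂span`.
        V-∂ : ∀ {y} → V y → V (∂ y)
        V-∂ {y} vy@(d , Sd , d≉0 , sp) = V-÷S Sd d≉0
          (V-resp (trans (+-congʳ (leibniz d y)) (solve 2 (λ x z → (x :+ z) :- x := z) refl _ _))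
            (V-+ (V-∂span m sp) (V-neg (V-*S (∂-closed Sd) vy))))

        V-iterate : ∀ n {y} → V y → All V (iterate ∂ y n)
        V-iterate zero    vy = []
        V-iterate (suc n) vy = vy ∷ V-iterate n (V-∂ vy)

  -- The `m + 1` elements obtained from `f` by iterating `∂` lie in a space spanned by `m` powers of
  -- `g`. The equation `s * f ≈ t * g` says `f = (t / s) g` without fractions.
  algebraic⇒D-finite :
    (∂ : Carrier → Carrier) → IsDerivation R ∂ → (∀ {s} → S s → S (∂ s)) →
    AlgebraicOver S g → ∀ {s t f} → S s → s ≉ 0# → S t → s * f ≈ t * g →
    ∃[ n ] NontrivialSpan (iterate ∂ f n) 0#
  algebraic⇒D-finite ∂ isDer ∂-closed alg {s} {t} {f} Ss s≉0 St sf≈tg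
    with separable alg
  ... | sep@(ks , Sks , any , eq , _) with leadingTerm g (length ks) (eval-nontrivial g Sks any)
  ...   | m , a , r , Sa , a≉0 , sr , eq′ =
    suc m , V-dependent (iterate ∂ f (suc m))
      (≡.subst (m ℕ.<_) (≡.sym (length-iterate ∂ f (suc m))) ℕₚ.≤-refl)
      (V-iterate ∂ isDer ∂-closed (V-∂g ∂ isDer ∂-closed sep) (suc m) vf)
    where
    reduction : Span (powers g m) (a * (g ^ m))
    reduction = span-resp (powers g m) (begin
      - r                             ≈⟨ solve 2 (λ r x → :- r := x :- (r :+ x)) refl r (a * (g ^ m)) ⟩
      a * (g ^ m) - (r + a * (g ^ m)) ≈⟨ +-congˡ (-‿cong (trans (sym eq′) eq)) ⟩
      a * (g ^ m) - 0#               ≈⟨ solve 1 (λ c → c :- con ℤ.0ℤ := c) refl _ ⟩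
      a * (g ^ m)                    ∎)
      (span-neg (powers g m) sr)
    open FiniteExtension m a Sa a≉0 reduction

    vf : V f
    vf = V-÷S Ss s≉0 (V-resp (sym sf≈tg) (V-*S St V-g))

-- The domain of formal power series, its polynomials and its Euler derivation.

module PowerSeries (K : CommutativeRing 0ℓ 0ℓ) where
  open CommutativeRing K hiding (zero)
  open RawSemiringDefs (Semiring.rawSemiring semiring) using (sum)
  open SemiringMultiples semiring using () renaming (_×_ to _·_)
  open LaurentSeries rawRing using (Laurent; shift; const)
  open IntegerSolver K
  open SetoidReasoning setoid

  Series : Set
  Series = ℕ → Carrier

  infix 4 _≋_
  _≋_ : Series → Series → Set
  f ≋ g = ∀ n → f n ≈ g n

  infixl 6 _⊕_
  _⊕_ : Series → Series → Series
  (f ⊕ g) n = f n + g n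

  infixl 7 _⊛_
  _⊛_ : Series → Series → Series
  (f ⊛ g) n = sum {suc n} λ i → f (toℕ i) * g (n ∸ toℕ i)

  𝟎 : Series
  𝟎 _ = 0#

  constant : Carrier → Series
  constant x = Laurent.coeffs (const x)

  𝟏 : Series
  𝟏 = constant 1#

  -- The proofs below recurse along (f ⊛ g) (suc n) = f 0 * g (suc n) + ((f ∘ suc) ⊛ g) n,
  -- which holds definitionally.

  ⊛-cong : ∀ {f f′ g g′} → f ≋ f′ → g ≋ g′ → f ⊛ g ≋ f′ ⊛ g′
  ⊛-cong f≋ g≋ zero    = +-congʳ (*-cong (f≋ 0) (g≋ 0))
  ⊛-cong f≋ g≋ (suc n) = +-cong (*-cong (f≋ 0) (g≋ (suc n))) (⊛-cong (f≋ ∘ suc) g≋ n)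

  ⊛-zeroˡ : ∀ {f} g → f ≋ 𝟎 → f ⊛ g ≋ 𝟎
  ⊛-zeroˡ g f≋0 zero    = trans (+-congʳ (*-congʳ (f≋0 0)))
    (solve 1 (λ y → con ℤ.0ℤ :* y :+ con ℤ.0ℤ := con ℤ.0ℤ) refl (g 0))
  ⊛-zeroˡ g f≋0 (suc n) = trans (+-cong (*-congʳ (f≋0 0)) (⊛-zeroˡ g (f≋0 ∘ suc) n))
    (solve 1 (λ y → con ℤ.0ℤ :* y :+ con ℤ.0ℤ := con ℤ.0ℤ) refl (g (suc n)))

  ⊛-distribʳ : ∀ h f g → (f ⊕ g) ⊛ h ≋ (f ⊛ h) ⊕ (g ⊛ h)
  ⊛-distribʳ h f g zero =
    solve 3 (λ x y z → (x :+ y) :* z :+ con ℤ.0ℤ := (x :* z :+ con ℤ.0ℤ) :+ (y :* z :+ con ℤ.0ℤ)) refl (f 0) (g 0) (h 0)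
  ⊛-distribʳ h f g (suc n) = trans (+-congˡ (⊛-distribʳ h (f ∘ suc) (g ∘ suc) n))
    (solve 5 (λ x y z s t → (x :+ y) :* z :+ (s :+ t) := (x :* z :+ s) :+ (y :* z :+ t))
      refl (f 0) (g 0) (h (suc n)) (((f ∘ suc) ⊛ h) n) (((g ∘ suc) ⊛ h) n))

  ⊛-scaleˡ : ∀ c f g → (λ n → c * f n) ⊛ g ≋ λ n → c * (f ⊛ g) n
  ⊛-scaleˡ c f g zero =
    solve 3 (λ c x y → (c :* x) :* y :+ con ℤ.0ℤ := c :* (x :* y :+ con ℤ.0ℤ)) refl c (f 0) (g 0)
  ⊛-scaleˡ c f g (suc n) = trans (+-congˡ (⊛-scaleˡ c (f ∘ suc) g n))
    (solve 4 (λ c x y s → (c :* x) :* y :+ c :* s := c :* (x :* y :+ s)) refl c (f 0) (g (suc n)) (((f ∘ suc) ⊛ g) n))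

  ⊛-assoc : ∀ f g h → (f ⊛ g) ⊛ h ≋ f ⊛ (g ⊛ h)
  ⊛-assoc f g h zero =
    solve 3 (λ x y z → (x :* y :+ con ℤ.0ℤ) :* z :+ con ℤ.0ℤ := x :* (y :* z :+ con ℤ.0ℤ) :+ con ℤ.0ℤ) refl (f 0) (g 0) (h 0)
  ⊛-assoc f g h (suc n) = begin
    (f 0 * g 0 + 0#) * h (suc n) + (((λ k → f 0 * g (suc k)) ⊕ ((f ∘ suc) ⊛ g)) ⊛ h) n
      ≈⟨ +-congˡ (⊛-distribʳ h (λ k → f 0 * g (suc k)) ((f ∘ suc) ⊛ g) n) ⟩
    (f 0 * g 0 + 0#) * h (suc n) + (((λ k → f 0 * g (suc k)) ⊛ h) n + (((f ∘ suc) ⊛ g) ⊛ h) n)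
      ≈⟨ +-congˡ (+-cong (⊛-scaleˡ (f 0) (g ∘ suc) h n) (⊛-assoc (f ∘ suc) g h n)) ⟩
    (f 0 * g 0 + 0#) * h (suc n) + (f 0 * ((g ∘ suc) ⊛ h) n + ((f ∘ suc) ⊛ (g ⊛ h)) n)
      ≈⟨ solve 5 (λ x y z s t → (x :* y :+ con ℤ.0ℤ) :* z :+ (x :* s :+ t) := x :* (y :* z :+ s) :+ t)
           refl (f 0) (g 0) (h (suc n)) (((g ∘ suc) ⊛ h) n) (((f ∘ suc) ⊛ (g ⊛ h)) n) ⟩
    f 0 * (g 0 * h (suc n) + ((g ∘ suc) ⊛ h) n) + ((f ∘ suc) ⊛ (g ⊛ h)) n ∎

  -- The mirror image of the defining recursion, splitting off the last summand; the two together
  -- give commutativity.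
  ⊛-suc : ∀ f g n → (f ⊛ g) (suc n) ≈ (f ⊛ (g ∘ suc)) n + f (suc n) * g 0
  ⊛-suc f g zero =
    solve 2 (λ s t → s :+ (t :+ con ℤ.0ℤ) := (s :+ con ℤ.0ℤ) :+ t) refl (f 0 * g 1) (f 1 * g 0)
  ⊛-suc f g (suc n) = trans (+-congˡ (⊛-suc (f ∘ suc) g n)) (sym (+-assoc _ _ _))

  ⊛-comm : ∀ f g → f ⊛ g ≋ g ⊛ f
  ⊛-comm f g zero    = +-congʳ (*-comm (f 0) (g 0))
  ⊛-comm f g (suc n) = begin
    f 0 * g (suc n) + ((f ∘ suc) ⊛ g) n ≈⟨ +-cong (*-comm _ _) (⊛-comm (f ∘ suc) g n) ⟩
    g (suc n) * f 0 + (g ⊛ (f ∘ suc)) n ≈⟨ +-comm _ _ ⟩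
    (g ⊛ (f ∘ suc)) n + g (suc n) * f 0 ≈⟨ ⊛-suc g f n ⟨
    (g ⊛ f) (suc n)                     ∎

  ⊛-constantˡ : ∀ c g → constant c ⊛ g ≋ λ n → c * g n
  ⊛-constantˡ c g zero    = +-identityʳ _
  ⊛-constantˡ c g (suc n) = trans (+-congˡ (⊛-zeroˡ g (λ _ → refl) n)) (+-identityʳ _)

  ⊛-identityˡ : ∀ g → 𝟏 ⊛ g ≋ g
  ⊛-identityˡ g n = trans (⊛-constantˡ 1# g n) (*-identityˡ (g n))

  ⊛-distribˡ : ∀ h f g → h ⊛ (f ⊕ g) ≋ (h ⊛ f) ⊕ (h ⊛ g)
  ⊛-distribˡ h f g n = begin
    (h ⊛ (f ⊕ g)) n             ≈⟨ ⊛-comm h (f ⊕ g) n ⟩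
    ((f ⊕ g) ⊛ h) n             ≈⟨ ⊛-distribʳ h f g n ⟩
    (f ⊛ h) n + (g ⊛ h) n       ≈⟨ +-cong (⊛-comm f h n) (⊛-comm g h n) ⟩
    (h ⊛ f) n + (h ⊛ g) n       ∎

  shift-zero : ∀ k {f} → f ≋ 𝟎 → shift k f ≋ 𝟎
  shift-zero zero    f≋0 n       = f≋0 n
  shift-zero (suc k) f≋0 zero    = refl
  shift-zero (suc k) f≋0 (suc n) = shift-zero k f≋0 n

  shift-cong : ∀ k {f g} → f ≋ g → shift k f ≋ shift k g
  shift-cong zero    f≋g n       = f≋g n
  shift-cong (suc k) f≋g zero    = refl
  shift-cong (suc k) f≋g (suc n) = shift-cong k f≋g n

  shift-injective : ∀ k {f g} → shift k f ≋ shift k g → f ≋ g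
  shift-injective zero    eq = eq
  shift-injective (suc k) eq = shift-injective k (eq ∘ suc)

  shift-⊛ : ∀ k f → shift k f ≋ shift k 𝟏 ⊛ f
  shift-⊛ zero    f n       = sym (⊛-identityˡ f n)
  shift-⊛ (suc k) f zero    = solve 1 (λ y → con ℤ.0ℤ := con ℤ.0ℤ :* y :+ con ℤ.0ℤ) refl (f 0)
  shift-⊛ (suc k) f (suc n) = trans (shift-⊛ k f n)
    (solve 2 (λ y s → s := con ℤ.0ℤ :* y :+ s) refl (f (suc n)) ((shift k 𝟏 ⊛ f) n))

  seriesRing : CommutativeRing 0ℓ 0ℓ
  seriesRing = record
    { Carrier = Series ; _≈_ = _≋_ ; _+_ = _⊕_ ; _*_ = _⊛_ ; -_ = λ f n → - f n ; 0# = 𝟎 ; 1# = 𝟏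
    ; isCommutativeRing = record
      { isRing = record
        { +-isAbelianGroup = Pointwise.isAbelianGroup ℕ +-isAbelianGroup
        ; *-cong = ⊛-cong
        ; *-assoc = ⊛-assoc
        ; *-identity = ⊛-identityˡ , λ g n → trans (⊛-comm g 𝟏 n) (⊛-identityˡ g n)
        ; distrib = ⊛-distribˡ , ⊛-distribʳ
        }
      ; *-comm = ⊛-comm
      }
    }

  private module P = CommutativeRing seriesRing

  -- Unlike `d/dX`, the derivation `X d/dX` leaves every coefficient at its index, so its iterates
  -- only multiply the coefficient at `n` by powers of `n`.
  θ : Series → Series
  θ f n = (n · 1#) * f n

  private
    θ-tail : ∀ f g n → (((θ f) ∘ suc) ⊛ g) n ≈ ((f ∘ suc) ⊛ g) n + (θ (f ∘ suc) ⊛ g) n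
    θ-tail f g n = trans (⊛-cong {g = g} (λ k → solve 2 (λ ν x → (con ℤ.1ℤ :+ ν) :* x := x :+ ν :* x) refl (k · 1#) (f (suc k))) (λ _ → refl) n)
      (⊛-distribʳ g (f ∘ suc) (θ (f ∘ suc)) n)

  θ-leibniz : ∀ f g → θ (f ⊛ g) ≋ (θ f ⊛ g) ⊕ (f ⊛ θ g)
  θ-leibniz f g zero =
    solve 2 (λ x y → con ℤ.0ℤ :* (x :* y :+ con ℤ.0ℤ) := ((con ℤ.0ℤ :* x) :* y :+ con ℤ.0ℤ) :+ (x :* (con ℤ.0ℤ :* y) :+ con ℤ.0ℤ)) refl (f 0) (g 0)
  θ-leibniz f g (suc n) = begin
    (1# + ν) * (f 0 * g (suc n) + T)
      ≈⟨ solve 3 (λ ν z t → (con ℤ.1ℤ :+ ν) :* (z :+ t) := ((con ℤ.1ℤ :+ ν) :* z :+ t) :+ ν :* t) refl ν (f 0 * g (suc n)) T ⟩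
    ((1# + ν) * (f 0 * g (suc n)) + T) + ν * T
      ≈⟨ +-congˡ (θ-leibniz (f ∘ suc) g n) ⟩
    ((1# + ν) * (f 0 * g (suc n)) + T) + (A + B)
      ≈⟨ solve 6 (λ ν x y t a b → ((con ℤ.1ℤ :+ ν) :* (x :* y) :+ t) :+ (a :+ b)
                               := ((con ℤ.0ℤ :* x) :* y :+ (t :+ a)) :+ (x :* ((con ℤ.1ℤ :+ ν) :* y) :+ b))
           refl ν (f 0) (g (suc n)) T A B ⟩
    (0# * f 0 * g (suc n) + (T + A)) + (f 0 * ((1# + ν) * g (suc n)) + B)
      ≈⟨ +-congʳ (+-congˡ (θ-tail f g n)) ⟨
    (0# * f 0 * g (suc n) + (((θ f) ∘ suc) ⊛ g) n) + (f 0 * ((1# + ν) * g (suc n)) + B) ∎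
    where
    ν = n · 1#
    T = ((f ∘ suc) ⊛ g) n
    A = (θ (f ∘ suc) ⊛ g) n
    B = ((f ∘ suc) ⊛ θ g) n

  θ-isDerivation : IsDerivation seriesRing θ
  θ-isDerivation = record
    { ∂-cong  = λ f≋g n → *-congˡ (f≋g n)
    ; ∂-+     = λ f g n → distribˡ _ _ _
    ; leibniz = θ-leibniz
    }

  IsPolynomial : Pred Series 0ℓ
  IsPolynomial f = ∃[ N ] (∀ n → N ℕ.≤ n → f n ≈ 0#)

  private
    polynomial-+ : ∀ {f g} → IsPolynomial f → IsPolynomial g → IsPolynomial (f ⊕ g)
    polynomial-+ (M , f≈0) (N , g≈0) = M ℕ.⊔ N , λ n le →
      trans (+-cong (f≈0 n (ℕₚ.m⊔n≤o⇒m≤o M N le)) (g≈0 n (ℕₚ.m⊔n≤o⇒n≤o M N le))) (+-identityˡ 0#)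

    polynomial-* : ∀ {f g} → IsPolynomial f → IsPolynomial g → IsPolynomial (f ⊛ g)
    polynomial-* {f} {g} (N , f≈0) (M , g≈0) = go N f f≈0
      where
      go : ∀ N f → (∀ n → N ℕ.≤ n → f n ≈ 0#) → IsPolynomial (f ⊛ g)
      go zero    f f≈0 = 0 , λ n _ → ⊛-zeroˡ g (λ k → f≈0 k ℕ.z≤n) n
      go (suc N) f f≈0 with go N (f ∘ suc) (λ n le → f≈0 (suc n) (ℕ.s≤s le))
      ... | L , fg≈0 = suc (M ℕ.⊔ L) , λ { (suc n) (ℕ.s≤s le) →
        trans (+-cong (*-congˡ (g≈0 (suc n) (ℕₚ.m≤n⇒m≤1+n (ℕₚ.m⊔n≤o⇒m≤o M L le)))) (fg≈0 n (ℕₚ.m⊔n≤o⇒n≤o M L le)))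
          (solve 1 (λ x → x :* con ℤ.0ℤ :+ con ℤ.0ℤ := con ℤ.0ℤ) refl (f 0)) }

  constant-isPolynomial : ∀ c → IsPolynomial (constant c)
  constant-isPolynomial c = 1 , λ { (suc n) _ → refl }

  shift-isPolynomial : ∀ k {f} → IsPolynomial f → IsPolynomial (shift k f)
  shift-isPolynomial zero    p = p
  shift-isPolynomial (suc k) p with shift-isPolynomial k p
  ... | N , eq = suc N , λ { (suc n) (ℕ.s≤s le) → eq n le }

  polynomial-isSubring : IsSubring seriesRing IsPolynomial
  polynomial-isSubring = record
    { resp     = λ { f≋g (N , f≈0) → N , λ n le → trans (sym (f≋g n)) (f≈0 n le) }
    ; 0-closed = 0 , λ _ _ → refl
    ; 1-closed = constant-isPolynomial 1#
    ; +-closed = polynomial-+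
    ; *-closed = polynomial-*
    ; -‿closed = λ { {f} (N , f≈0) → N , λ n le → trans (-‿cong (f≈0 n le)) (solve 0 (:- con ℤ.0ℤ := con ℤ.0ℤ) refl) }
    }

  θ-polynomial : ∀ {f} → IsPolynomial f → IsPolynomial (θ f)
  θ-polynomial (N , f≈0) = N , λ n le → trans (*-congˡ (f≈0 n le)) (zeroʳ _)

  module _ (em : ExcludedMiddle 0ℓ) where

    someCoefficient : ∀ {f} → ¬ (f ≋ 𝟎) → ∃[ n ] (f n ≉ 0#)
    someCoefficient {f} f≉0 with em {∃[ n ] (f n ≉ 0#)}
    ... | yes ex = ex
    ... | no ¬ex = ⊥-elim (f≉0 zeros)
      where
      zeros : f ≋ 𝟎
      zeros n with em {f n ≈ 0#}
      ... | yes eq = eq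
      ... | no neq = ⊥-elim (¬ex (n , neq))

  module _ (em : ExcludedMiddle 0ℓ) (isDomain : IsCharZeroDomain K) where
    open IsCharZeroDomain isDomain

    private
      open SemiringMultiples P.semiring using () renaming (_×_ to _·ₛ_)

      ·ₛ-0 : ∀ n → (n ·ₛ 𝟏) 0 ≈ n · 1#
      ·ₛ-0 zero    = refl
      ·ₛ-0 (suc n) = +-congˡ (·ₛ-0 n)

      -- A vanishing constant term is stripped from `f` or `g`, which divides the product by `X`;
      -- `a` and `b` bound how often this can happen. Once both constant terms are nonzero, their
      -- product is the constant term of `f ⊛ g`.
      ⊛-≉0 : ∀ a b f g → f a ≉ 0# → g b ≉ 0# → ¬ (f ⊛ g ≋ 𝟎)
      ⊛-≉0 a b f g fa gb fg≋0 with em {f 0 ≈ 0#} | em {g 0 ≈ 0#}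
      ... | no f0 | no g0 = *-≉0 f0 g0 (trans (sym (+-identityʳ _)) (fg≋0 0))
      ⊛-≉0 zero    b f g fa gb fg≋0 | yes f0 | _ = fa f0
      ⊛-≉0 (suc a) b f g fa gb fg≋0 | yes f0 | _ = ⊛-≉0 a b (f ∘ suc) g fa gb λ n → begin
        ((f ∘ suc) ⊛ g) n                     ≈⟨ solve 2 (λ y s → s := con ℤ.0ℤ :* y :+ s) refl (g (suc n)) _ ⟩
        0# * g (suc n) + ((f ∘ suc) ⊛ g) n    ≈⟨ +-congʳ (*-congʳ f0) ⟨
        (f ⊛ g) (suc n)                       ≈⟨ fg≋0 (suc n) ⟩
        0#                                    ∎
      ⊛-≉0 a zero    f g fa gb fg≋0 | no _ | yes g0 = gb g0
      ⊛-≉0 a (suc b) f g fa gb fg≋0 | no _ | yes g0 = ⊛-≉0 a b f (g ∘ suc) fa gb λ n → begin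
        (f ⊛ (g ∘ suc)) n                     ≈⟨ solve 2 (λ y s → s := s :+ y :* con ℤ.0ℤ) refl (f (suc n)) _ ⟩
        (f ⊛ (g ∘ suc)) n + f (suc n) * 0#    ≈⟨ +-congˡ (*-congˡ g0) ⟨
        (f ⊛ (g ∘ suc)) n + f (suc n) * g 0   ≈⟨ ⊛-suc f g n ⟨
        (f ⊛ g) (suc n)                       ≈⟨ fg≋0 (suc n) ⟩
        0#                                    ∎

    series-isDomain : IsCharZeroDomain seriesRing
    series-isDomain = record
      { noZeroDivisors = nzd
      ; charZero       = λ n eq → charZero n (trans (sym (·ₛ-0 (suc n))) (eq 0))
      }
      where
      nzd : ∀ {f g} → f ⊛ g ≋ 𝟎 → (f ≋ 𝟎) ⊎ (g ≋ 𝟎)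
      nzd {f} {g} fg≋0 with em {f ≋ 𝟎} | em {g ≋ 𝟎}
      ... | yes f≋0 | _       = inj₁ f≋0
      ... | no _    | yes g≋0 = inj₂ g≋0
      ... | no f≉0  | no g≉0  with someCoefficient em f≉0 | someCoefficient em g≉0
      ...   | a , fa | b , gb = ⊥-elim (⊛-≉0 a b f g fa gb fg≋0)

-- Recurrence of factors in infinite words.

InfinitelyOften : (ℕ → Set) → Set
InfinitelyOften P = ∀ m → ∃[ n ] (m ℕ.≤ n × P n)

module Classical (em : ExcludedMiddle 0ℓ) where

  ¬infinitelyOften : ∀ {P} → ¬ InfinitelyOften P → ∃[ m ] (∀ n → m ℕ.≤ n → ¬ P n)
  ¬infinitelyOften {P} ¬io with em {∃[ m ] (∀ n → m ℕ.≤ n → ¬ P n)}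
  ... | yes ex = ex
  ... | no ¬ex = ⊥-elim (¬io io)
    where
    io : InfinitelyOften P
    io m with em {∃[ n ] (m ℕ.≤ n × P n)}
    ... | yes ex  = ex
    ... | no ¬ex′ = ⊥-elim (¬ex (m , λ n m≤n Pn → ¬ex′ (n , m≤n , Pn)))

  uniformBound : ∀ N (P : Vec Letter N → ℕ → Set) →
                 (∀ u → ∃[ m ] (∀ n → m ℕ.≤ n → P u n)) →
                 ∃[ m ] (∀ n → m ℕ.≤ n → ∀ u → P u n)
  uniformBound zero    P bound with bound []
  ... | m , p = m , λ { n m≤n [] → p n m≤n }
  uniformBound (suc N) P bound
    with uniformBound N (P ∘ (a₁ ∷_)) (bound ∘ (a₁ ∷_)) | uniformBound N (P ∘ (a₂ ∷_)) (bound ∘ (a₂ ∷_))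
  ... | m₁ , p₁ | m₂ , p₂ = m₁ ℕ.⊔ m₂ , λ
    { n m≤n (a₁ ∷ u) → p₁ n (ℕₚ.m⊔n≤o⇒m≤o m₁ m₂ m≤n) u
    ; n m≤n (a₂ ∷ u) → p₂ n (ℕₚ.m⊔n≤o⇒n≤o m₁ m₂ m≤n) u }

module Words (em : ExcludedMiddle 0ℓ) (w : InfiniteWord) where
  open Classical em

  Agree : ℕ → ℕ → ℕ → Set
  Agree N n n′ = ∀ k → k ℕ.≤ N → w (k ℕ.+ n) ≡ w (k ℕ.+ n′)

  private
    window : ∀ N → ℕ → Vec Letter N
    window zero    n = []
    window (suc N) n = w (N ℕ.+ n) ∷ window N n

    window-injective : ∀ N {n n′} → window N n ≡ window N n′ → ∀ k → k ℕ.< N → w (k ℕ.+ n) ≡ w (k ℕ.+ n′)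
    window-injective (suc N) eq k (ℕ.s≤s k≤N) with ∷-injective eq | ℕₚ.m≤n⇒m<n∨m≡n k≤N
    ... | eq₀ , _ | inj₂ ≡.refl = eq₀
    ... | _ , eq′ | inj₁ k<N    = window-injective N eq′ k k<N

  -- There are finitely many words of length `N + 1`. One that does not occur infinitely often is
  -- absent from some position on, and `Z` lies beyond all these positions.
  recurrent : ∀ N → ∃[ Z ] (∀ n → Z ℕ.≤ n → InfinitelyOften λ n′ → Agree N n′ n)
  recurrent N with uniformBound (suc N) P bound
    where
    P : Vec Letter (suc N) → ℕ → Set
    P u n = window (suc N) n ≡ u → InfinitelyOften λ n′ → window (suc N) n′ ≡ u

    bound : ∀ u → ∃[ m ] (∀ n → m ℕ.≤ n → P u n)
    bound u with em {InfinitelyOften λ n′ → window (suc N) n′ ≡ u}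
    ... | yes io = 0 , λ _ _ _ → io
    ... | no ¬io with ¬infinitelyOften ¬io
    ...   | m , never = m , λ n m≤n eq → contradiction eq (never n m≤n)
  ... | Z , p = Z , λ n Z≤n m →
    let n′ , m≤n′ , eq = p n Z≤n (window (suc N) n) ≡.refl m
    in n′ , m≤n′ , λ k k≤N → window-injective (suc N) eq k (ℕ.s≤s k≤N)

  -- A window that occurs at both `n` and `n′` is followed by the same letter at both places, so the
  -- two positions stay in step forever and `n′ ∸ n` is a period.
  determined⇒periodic : ∀ Z N →
    (∀ n n′ → Z ℕ.≤ n → Z ℕ.≤ n′ → Agree N n n′ → w (suc N ℕ.+ n) ≡ w (suc N ℕ.+ n′)) →
    EventuallyPeriodic w
  determined⇒periodic Z N next = n , d , 1≤d , periodic
    where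
    Z′ = proj₁ (recurrent N)
    n = Z ℕ.⊔ Z′
    -- The search starts at `suc n`, so the second occurrence is strictly later and `1 ≤ d`.
    again = proj₂ (recurrent N) n (ℕₚ.m≤n⊔m Z Z′) (suc n)
    n′ = proj₁ again
    n<n′ : n ℕ.< n′
    n<n′ = proj₁ (proj₂ again)
    d = n′ ∸ n
    1≤d : 1 ℕ.≤ d
    1≤d = ℕₚ.m<n⇒0<n∸m n<n′
    n+d≡n′ : n ℕ.+ d ≡ n′
    n+d≡n′ = ℕₚ.m+[n∸m]≡n (ℕₚ.<⇒≤ n<n′)

    Z≤n : ∀ j → Z ℕ.≤ j ℕ.+ n
    Z≤n j = ℕₚ.≤-trans (ℕₚ.m≤m⊔n Z Z′) (ℕₚ.m≤n+m n j)

    agree : ∀ j → Agree N (j ℕ.+ n) (j ℕ.+ n′)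
    agree zero    k k≤N = ≡.sym (proj₂ (proj₂ again) k k≤N)
    agree (suc j) k k≤N with ℕₚ.m≤n⇒m<n∨m≡n k≤N
    ... | inj₁ k<N = ≡.subst₂ (λ x y → w x ≡ w y) (≡.sym (ℕₚ.+-suc k (j ℕ.+ n))) (≡.sym (ℕₚ.+-suc k (j ℕ.+ n′)))
                       (agree j (suc k) k<N)
    ... | inj₂ ≡.refl = ≡.subst₂ (λ x y → w x ≡ w y) (≡.sym (ℕₚ.+-suc k (j ℕ.+ n))) (≡.sym (ℕₚ.+-suc k (j ℕ.+ n′)))
                       (next (j ℕ.+ n) (j ℕ.+ n′) (Z≤n j) (ℕₚ.≤-trans (Z≤n j) (ℕₚ.+-monoʳ-≤ j (ℕₚ.<⇒≤ n<n′))) (agree j))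

    periodic : ∀ x → n ℕ.≤ x → w (x ℕ.+ d) ≡ w x
    periodic x n≤x = ≡.trans (≡.cong w x+d≡) (≡.trans (≡.sym (agree j 0 ℕ.z≤n)) (≡.cong w (ℕₚ.m∸n+n≡m n≤x)))
      where
      j = x ∸ n
      x+d≡ : x ℕ.+ d ≡ j ℕ.+ n′
      x+d≡ = ≡.trans (≡.cong (ℕ._+ d) (≡.sym (ℕₚ.m∸n+n≡m n≤x)))
        (≡.trans (ℕₚ.+-assoc j n d) (≡.cong (j ℕ.+_) n+d≡n′))

-- Polynomial functions on the natural numbers and their roots.

module PolynomialFunctions (em : ExcludedMiddle 0ℓ) (K : CommutativeRing 0ℓ 0ℓ) (isDomain : IsCharZeroDomain K) where
  open CommutativeRing K hiding (zero)
  open IsCharZeroDomain isDomain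
  open SemiringMultiples semiring using (×-homo-+) renaming (_×_ to _·_)
  open RingProperties ring using (+-cancelʳ)
  open Algebraicity rawRing using (eval)
  open IntegerSolver K
  open SetoidReasoning setoid
  open Classical em

  ι : ℕ → Carrier
  ι n = n · 1#

  -- Functions ℕ → K of degree < d, characterised by p(x) − p(r) = (x − r) q(x)
  -- with q of degree < d − 1, for every r.
  Degree< : ℕ → (ℕ → Carrier) → Set
  Degree< zero    p = ∀ x → p x ≈ 0#
  Degree< (suc d) p = ∀ r → ∃[ q ] (Degree< d q × (∀ x → p x + ι r * q x ≈ p r + ι x * q x))

  degree-0 : ∀ d → Degree< d (λ _ → 0#)
  degree-0 zero    x = refl
  degree-0 (suc d) r = (λ _ → 0#) , degree-0 d , λ x →
    solve 2 (λ r x → con ℤ.0ℤ :+ r :* con ℤ.0ℤ := con ℤ.0ℤ :+ x :* con ℤ.0ℤ) refl (ι r) (ι x)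

  degree-+ : ∀ d {p p′} → Degree< d p → Degree< d p′ → Degree< d (λ x → p x + p′ x)
  degree-+ zero    P P′ x = trans (+-cong (P x) (P′ x)) (+-identityˡ 0#)
  degree-+ (suc d) {p} {p′} P P′ r with P r | P′ r
  ... | q , Q , eq | q′ , Q′ , eq′ = (λ x → q x + q′ x) , degree-+ d Q Q′ , λ x → begin
    (p x + p′ x) + ι r * (q x + q′ x)
      ≈⟨ solve 5 (λ p p′ r q q′ → (p :+ p′) :+ r :* (q :+ q′) := (p :+ r :* q) :+ (p′ :+ r :* q′)) refl (p x) (p′ x) (ι r) (q x) (q′ x) ⟩
    (p x + ι r * q x) + (p′ x + ι r * q′ x) ≈⟨ +-cong (eq x) (eq′ x) ⟩
    (p r + ι x * q x) + (p′ r + ι x * q′ x)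
      ≈⟨ solve 5 (λ p p′ r q q′ → (p :+ r :* q) :+ (p′ :+ r :* q′) := (p :+ p′) :+ r :* (q :+ q′)) refl (p r) (p′ r) (ι x) (q x) (q′ x) ⟩
    (p r + p′ r) + ι x * (q x + q′ x) ∎

  degree-* : ∀ d {p} c → Degree< d p → Degree< d (λ x → p x * c)
  degree-* zero    c P x = trans (*-congʳ (P x)) (zeroˡ c)
  degree-* (suc d) {p} c P r with P r
  ... | q , Q , eq = (λ x → q x * c) , degree-* d c Q , λ x → begin
    p x * c + ι r * (q x * c)  ≈⟨ solve 4 (λ p r q c → p :* c :+ r :* (q :* c) := (p :+ r :* q) :* c) refl (p x) (ι r) (q x) c ⟩
    (p x + ι r * q x) * c      ≈⟨ *-congʳ (eq x) ⟩
    (p r + ι x * q x) * c      ≈⟨ solve 4 (λ p r q c → (p :+ r :* q) :* c := p :* c :+ r :* (q :* c)) refl (p r) (ι x) (q x) c ⟩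
    p r * c + ι x * (q x * c)  ∎

  -- The quotient of the translate at `r` is the translate of the quotient at `k + r`. The division
  -- form of `Degree<` thus replaces a binomial expansion.
  degree-shift : ∀ d {p} k → Degree< d p → Degree< d (λ x → p (k ℕ.+ x))
  degree-shift zero    k P x = P (k ℕ.+ x)
  degree-shift (suc d) {p} k P r with P (k ℕ.+ r)
  ... | q , Q , eq = (λ x → q (k ℕ.+ x)) , degree-shift d k Q , λ x →
    +-cancelʳ (ι k * q (k ℕ.+ x)) _ _ (begin
      p (k ℕ.+ x) + ι r * q (k ℕ.+ x) + ι k * q (k ℕ.+ x) ≈⟨ collect r (p (k ℕ.+ x)) (q (k ℕ.+ x)) ⟩
      p (k ℕ.+ x) + ι (k ℕ.+ r) * q (k ℕ.+ x)             ≈⟨ eq (k ℕ.+ x) ⟩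
      p (k ℕ.+ r) + ι (k ℕ.+ x) * q (k ℕ.+ x)             ≈⟨ collect x (p (k ℕ.+ r)) (q (k ℕ.+ x)) ⟨
      p (k ℕ.+ r) + ι x * q (k ℕ.+ x) + ι k * q (k ℕ.+ x) ∎)
    where
    collect : ∀ r y z → y + ι r * z + ι k * z ≈ y + ι (k ℕ.+ r) * z
    collect r y z = trans
      (solve 4 (λ y r k z → y :+ r :* z :+ k :* z := y :+ (k :+ r) :* z) refl y (ι r) (ι k) z)
      (+-congˡ (*-congʳ (sym (×-homo-+ 1# k r))))

  -- With `p(x) - p(r) = (x - r) q(x)`, one has `x p(x) - r p(r) = (x - r) (p(r) + x q(x))`, and the
  -- new quotient is again of Horner form.
  degree-horner : ∀ d {p} c → Degree< d p → Degree< (suc d) (λ x → c + ι x * p x)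
  degree-horner zero {p} c P r = (λ _ → 0#) , (λ _ → refl) , λ x → begin
    (c + ι x * p x) + ι r * 0#  ≈⟨ +-congʳ (+-congˡ (*-congˡ (P x))) ⟩
    (c + ι x * 0#) + ι r * 0#   ≈⟨ solve 3 (λ c x r → (c :+ x :* con ℤ.0ℤ) :+ r :* con ℤ.0ℤ := (c :+ r :* con ℤ.0ℤ) :+ x :* con ℤ.0ℤ) refl c (ι x) (ι r) ⟩
    (c + ι r * 0#) + ι x * 0#   ≈⟨ +-congʳ (+-congˡ (*-congˡ (P r))) ⟨
    (c + ι r * p r) + ι x * 0#  ∎
  degree-horner (suc d) {p} c P r with P r
  ... | q , Q , eq = (λ x → p r + ι x * q x) , degree-horner d (p r) Q , λ x → begin
    (c + ι x * p x) + ι r * (p r + ι x * q x)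
      ≈⟨ solve 6 (λ c x p r p′ q → (c :+ x :* p) :+ r :* (p′ :+ x :* q) := (c :+ r :* p′) :+ x :* (p :+ r :* q)) refl c (ι x) (p x) (ι r) (p r) (q x) ⟩
    (c + ι r * p r) + ι x * (p x + ι r * q x)  ≈⟨ +-congˡ (*-congˡ (eq x)) ⟩
    (c + ι r * p r) + ι x * (p r + ι x * q x)  ∎

  degree-eval : ∀ ks → Degree< (length ks) (λ x → eval ks (ι x))
  degree-eval []       x = refl
  degree-eval (k ∷ ks)   = degree-horner (length ks) k (degree-eval ks)

  -- Dividing by a root `r` leaves a quotient that vanishes at every root `n > r`, because `n - r`
  -- is a positive integer and hence nonzero in characteristic zero. These roots are still
  -- infinitely many, so the quotient is zero by induction.
  manyRoots⇒zero : ∀ d {p} → Degree< d p → InfinitelyOften (λ n → p n ≈ 0#) → ∀ n → p n ≈ 0#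
  manyRoots⇒zero zero    P _  = P
  manyRoots⇒zero (suc d) {p} P io with io 0
  ... | r , _ , pr≈0 with P r
  ...   | q , Q , eq = λ x → begin
    p x               ≈⟨ solve 2 (λ y r → y := y :+ r :* con ℤ.0ℤ) refl (p x) (ι r) ⟩
    p x + ι r * 0#    ≈⟨ +-congˡ (*-congˡ (q≈0 x)) ⟨
    p x + ι r * q x   ≈⟨ eq x ⟩
    p r + ι x * q x   ≈⟨ +-cong pr≈0 (*-congˡ (q≈0 x)) ⟩
    0# + ι x * 0#     ≈⟨ solve 1 (λ x → con ℤ.0ℤ :+ x :* con ℤ.0ℤ := con ℤ.0ℤ) refl (ι x) ⟩
    0#                ∎
    where
    root : ∀ j → p (suc j ℕ.+ r) ≈ 0# → q (suc j ℕ.+ r) ≈ 0#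
    root j px≈0 = *-cancel-≉0 (charZero j) (+-cancelʳ (ι r * y) _ _ (begin
      ι (suc j) * y + ι r * y        ≈⟨ distribʳ y (ι (suc j)) (ι r) ⟨
      (ι (suc j) + ι r) * y          ≈⟨ *-congʳ (×-homo-+ 1# (suc j) r) ⟨
      ι (suc j ℕ.+ r) * y            ≈⟨ +-identityˡ _ ⟨
      0# + ι (suc j ℕ.+ r) * y       ≈⟨ +-congʳ pr≈0 ⟨
      p r + ι (suc j ℕ.+ r) * y      ≈⟨ eq (suc j ℕ.+ r) ⟨
      p (suc j ℕ.+ r) + ι r * y      ≈⟨ +-congʳ px≈0 ⟩
      0# + ι r * y                   ∎))
      where y = q (suc j ℕ.+ r)

    q≈0 : ∀ x → q x ≈ 0#
    q≈0 = manyRoots⇒zero d Q λ m →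
      let n , m⊔r<n , pn≈0 = io (m ℕ.⊔ suc r)
          n≡ = ℕₚ.m∸n+n≡m (ℕₚ.m⊔n≤o⇒n≤o m (suc r) m⊔r<n)
          n≡′ = ≡.trans (≡.sym (ℕₚ.+-suc (n ∸ suc r) r)) n≡
      in n , ℕₚ.m⊔n≤o⇒m≤o m (suc r) m⊔r<n ,
         ≡.subst (λ n → q n ≈ 0#) n≡′
           (root (n ∸ suc r) (≡.subst (λ n → p n ≈ 0#) (≡.sym n≡′) pn≈0))

  -- With infinitely many roots the function would be zero. Its value at `0` is the constant
  -- coefficient, and for `n > 0` the factor `ι n` cancels from the rest, so all coefficients would
  -- vanish in turn.
  eval-nonzero : ∀ ks → Any (_≉ 0#) ks → ∃[ m ] (∀ n → m ℕ.≤ n → eval ks (ι n) ≉ 0#)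
  eval-nonzero ks any = ¬infinitelyOften λ io → go ks any (manyRoots⇒zero (length ks) (degree-eval ks) io)
    where
    go : ∀ ks → Any (_≉ 0#) ks → ¬ (∀ n → eval ks (ι n) ≈ 0#)
    go (k ∷ ks) any zeros = refute any
      where
      k≈0 : k ≈ 0#
      k≈0 = trans (solve 2 (λ k e → k := k :+ con ℤ.0ℤ :* e) refl k (eval ks (ι 0))) (zeros 0)

      tailZeros : ∀ n → eval ks (ι n) ≈ 0#
      tailZeros = manyRoots⇒zero (length ks) (degree-eval ks) λ m →
        suc m , ℕₚ.n≤1+n m , *-cancel-≉0 (charZero m) (begin
          ι (suc m) * eval ks (ι (suc m))      ≈⟨ +-identityˡ _ ⟨
          0# + ι (suc m) * eval ks (ι (suc m)) ≈⟨ +-congʳ k≈0 ⟨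
          k + ι (suc m) * eval ks (ι (suc m))  ≈⟨ zeros (suc m) ⟩
          0#                                   ∎)

      refute : ¬ Any (_≉ 0#) (k ∷ ks)
      refute (here k≉0)  = k≉0 k≈0
      refute (there any) = go ks any tailZeros

-- From a differential equation for the letter series to periodicity of the word.

module FiniteAlphabet
  (em : ExcludedMiddle 0ℓ) (K : CommutativeRing 0ℓ 0ℓ) (isDomain : IsCharZeroDomain K)
  (w : InfiniteWord) (value : Letter → CommutativeRing.Carrier K)
  (value-injective : ∀ {x y} → CommutativeRing._≈_ K (value x) (value y) → x ≡ y)
  where
  open CommutativeRing K hiding (zero)
  open IsCharZeroDomain isDomain
  open RingProperties ring using (x∙y⁻¹≈ε⇒x≈y)
  open Algebraicity rawRing using (eval)
  open IntegerSolver K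
  open SetoidReasoning setoid
  open PolynomialFunctions em K isDomain
  open PowerSeries K
  open LinearDependence em seriesRing (series-isDomain em isDomain) IsPolynomial polynomial-isSubring
  open Words em w

  series : Series
  series n = value (w n)

  -- convolve e f m = Σ_{s ≤ m} e s (m − s) f(m − s)
  convolve : (ℕ → ℕ → Carrier) → Series → Series
  convolve e f zero    = e 0 0 * f 0
  convolve e f (suc m) = e 0 (suc m) * f (suc m) + convolve (e ∘ suc) f m

  convolve-zero : ∀ {e} f → (∀ s t → e s t ≈ 0#) → convolve e f ≋ 𝟎
  convolve-zero f e≈0 zero    = trans (*-congʳ (e≈0 0 0)) (zeroˡ _)
  convolve-zero f e≈0 (suc m) = trans (+-cong (trans (*-congʳ (e≈0 0 (suc m))) (zeroˡ _)) (convolve-zero f (λ s → e≈0 (suc s)) m))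
    (+-identityˡ 0#)

  -- `θ` multiplies the coefficient at `t` by `t`, so the polynomials acting on `θ f` act on `f`
  -- after multiplication by `t`; the product `c ⊛ f` supplies their constant terms.
  convolve-horner : ∀ c e f m →
    (c ⊛ f) m + convolve e (θ f) m ≈ convolve (λ s t → c s + ι t * e s t) f m
  convolve-horner c e f zero =
    solve 3 (λ c f e → (c :* f :+ con ℤ.0ℤ) :+ e :* (con ℤ.0ℤ :* f) := (c :+ con ℤ.0ℤ :* e) :* f) refl (c 0) (f 0) (e 0 0)
  convolve-horner c e f (suc m) = trans
    (solve 6 (λ c f e ν a b → (c :* f :+ a) :+ (e :* (ν :* f) :+ b) := (c :+ ν :* e) :* f :+ (a :+ b))
      refl (c 0) (f (suc m)) (e 0 (suc m)) (ι (suc m)) (((c ∘ suc) ⊛ f) m) (convolve (e ∘ suc) (θ f) m))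
    (+-congˡ (convolve-horner (c ∘ suc) (e ∘ suc) f m))

  -- The operator Σ_i c_i θ^i is stored by the polynomials p_s(t) = Σ_i c_i(s) tⁱ,
  -- since (c θⁱ f)(m) = Σ_s c(s) (m − s)ⁱ f(m − s).
  record Operator (n : ℕ) (f y : Series) : Set where
    field
      column        : ℕ → List Carrier
      length-column : ∀ s → length (column s) ≡ n
      bound         : ℕ
      vanishing     : ∀ s → bound ℕ.≤ s → ∀ t → eval (column s) (ι t) ≈ 0#
      acts          : y ≋ convolve (λ s t → eval (column s) (ι t)) f

  open Operator

  cons : ∀ {n f y c r} → IsPolynomial c → Operator n (θ f) r → y ≋ (c ⊛ f) ⊕ r → Operator (suc n) f y
  cons {n} {f} {y} {c} {r} (N , c≈0) O eq = record
    { column        = λ s → c s ∷ column O s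
    ; length-column = λ s → ≡.cong suc (length-column O s)
    ; bound         = N ℕ.⊔ bound O
    ; vanishing     = λ s le t → trans
        (+-cong (c≈0 s (ℕₚ.m⊔n≤o⇒m≤o N _ le)) (*-congˡ (vanishing O s (ℕₚ.m⊔n≤o⇒n≤o N _ le) t)))
        (solve 1 (λ x → con ℤ.0ℤ :+ x :* con ℤ.0ℤ := con ℤ.0ℤ) refl (ι t))
    ; acts          = λ m → trans (eq m) (trans (+-congˡ (acts O m)) (convolve-horner c _ f m))
    }

  span⇒operator : ∀ n f {y} → Span (iterate θ f n) y → Operator n f y
  span⇒operator zero    f y≋0 = record
    { column = λ _ → [] ; length-column = λ _ → ≡.refl ; bound = 0 ; vanishing = λ _ _ _ → refl
    ; acts = λ m → trans (y≋0 m) (sym (convolve-zero f (λ _ _ → refl) m)) }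
  span⇒operator (suc n) f (c , r , pc , sr , eq) = cons pc (span⇒operator n (θ f) sr) eq

  -- A transposition: a coefficient series `c` that is not zero has a nonzero entry at some `s`, and
  -- this entry makes column `s` nonzero.
  nontrivial⇒operator : ∀ n f {y} → NontrivialSpan (iterate θ f n) y →
    ∃[ O ] ∃[ s ] Any (_≉ 0#) (column {n} {f} {y} O s)
  nontrivial⇒operator (suc n) f (c , r , pc , inj₁ (c≉0 , sr) , eq) =
    let s , cs≉0 = someCoefficient em c≉0
    in cons pc (span⇒operator n (θ f) sr) eq , s , here cs≉0
  nontrivial⇒operator (suc n) f (c , r , pc , inj₂ nr , eq) =
    let O , s , any = nontrivial⇒operator n (θ f) nr
    in cons pc O eq , s , there any

  -- Σ_{s < N} e s (N − s + T) f(N − s + n): the letters are read near n,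
  -- while the polynomials are evaluated near T.
  windowSum : (ℕ → ℕ → Carrier) → ℕ → ℕ → ℕ → Carrier
  windowSum e zero    n T = 0#
  windowSum e (suc N) n T = e 0 (suc N ℕ.+ T) * series (suc N ℕ.+ n) + windowSum (e ∘ suc) N n T

  -- At index `N + n` the convolution has all the summands with `s < N`, which read the letters at
  -- `N + n` down to `1 + n`; the later ones vanish.
  convolve-windowSum : ∀ N e n → (∀ s → N ℕ.≤ s → ∀ t → e s t ≈ 0#) →
                       convolve e series (N ℕ.+ n) ≈ windowSum e N n n
  convolve-windowSum zero    e n e≈0 = convolve-zero series (λ s → e≈0 s ℕ.z≤n) n
  convolve-windowSum (suc N) e n e≈0 =
    +-congˡ (convolve-windowSum N (e ∘ suc) n (λ s le → e≈0 (suc s) (ℕ.s≤s le)))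

  -- With the letters frozen near `n`, they are constant factors as `T` varies.
  degree-windowSum : ∀ d {e} N n → (∀ s → Degree< d (e s)) → Degree< d (windowSum e N n)
  degree-windowSum d zero    n E = degree-0 d
  degree-windowSum d (suc N) n E = degree-+ d
    (degree-* d _ (degree-shift d (suc N) (E 0))) (degree-windowSum d N n (E ∘ suc))

  windowSum-local : ∀ e N {n n′} T → Agree N n n′ → windowSum e N n T ≈ windowSum e N n′ T
  windowSum-local e zero    T agree = refl
  windowSum-local e (suc N) T agree = +-cong
    (*-congˡ (reflexive (≡.cong value (agree (suc N) ℕₚ.≤-refl))))
    (windowSum-local (e ∘ suc) N T (λ k k≤N → agree k (ℕₚ.m≤n⇒m≤1+n k≤N)))

  -- Columns without a nonzero coefficient are dropped from the front, each shortening the window by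
  -- one. The first remaining column multiplies the latest letter; at an argument where it is
  -- nonzero, the relation can be solved for the value of that letter in terms of the earlier ones.
  determined : ∀ Z N (col : ℕ → List Carrier) →
    (∀ s → N ℕ.≤ s → ∀ t → eval (col s) (ι t) ≈ 0#) →
    ∃[ s ] Any (_≉ 0#) (col s) →
    (∀ n → Z ℕ.≤ n → ∀ T → windowSum (λ s t → eval (col s) (ι t)) N n T ≈ 0#) →
    ∃[ M ] (∀ n n′ → Z ℕ.≤ n → Z ℕ.≤ n′ → Agree M n n′ → w (suc M ℕ.+ n) ≡ w (suc M ℕ.+ n′))
  determined Z zero col vanish (s , any) _ with eval-nonzero (col s) any
  ... | m , nonzero = ⊥-elim (nonzero m ℕₚ.≤-refl (vanish s ℕ.z≤n m))
  determined Z (suc N) col vanish (s , any) zeros with em {Any (_≉ 0#) (col 0)}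
  ... | yes any₀ with eval-nonzero (col 0) any₀
  -- The threshold of `eval-nonzero` itself serves as `T`, since the polynomial is evaluated at
  -- `suc N + T`, which lies beyond it.
  ...   | T , nonzero = N , λ n n′ Z≤n Z≤n′ agree → value-injective
    (x∙y⁻¹≈ε⇒x≈y _ _ (*-cancel-≉0 (nonzero (suc N ℕ.+ T) (ℕₚ.m≤n+m T (suc N)))
      (begin
        γ * (series (suc N ℕ.+ n) - series (suc N ℕ.+ n′))
          ≈⟨ solve 4 (λ γ x y z → γ :* (x :- y) := (γ :* x :+ z) :- (γ :* y :+ z)) refl γ _ _ (rest n′) ⟩
        (γ * series (suc N ℕ.+ n) + rest n′) - (γ * series (suc N ℕ.+ n′) + rest n′)
          ≈⟨ +-congʳ (+-congˡ (windowSum-local (λ s t → eval (col (suc s)) (ι t)) N T agree)) ⟨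
        (γ * series (suc N ℕ.+ n) + rest n) - (γ * series (suc N ℕ.+ n′) + rest n′)
          ≈⟨ +-cong (zeros n Z≤n T) (-‿cong (zeros n′ Z≤n′ T)) ⟩
        0# - 0# ≈⟨ -‿inverseʳ 0# ⟩
        0# ∎)))
    where
    γ = eval (col 0) (ι (suc N ℕ.+ T))
    rest : ℕ → Carrier
    rest n = windowSum (λ s t → eval (col (suc s)) (ι t)) N n T
  determined Z (suc N) col vanish (zero , any) zeros | no ¬any = contradiction any ¬any
  determined Z (suc N) col vanish (suc s , any) zeros | no ¬any =
    determined Z N (col ∘ suc) (λ s le → vanish (suc s) (ℕ.s≤s le)) (s , any) λ n Z≤n T → begin
      _                                 ≈⟨ solve 2 (λ x y → y := con ℤ.0ℤ :* x :+ y) refl (series (suc N ℕ.+ n)) _ ⟩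
      0# * series (suc N ℕ.+ n) + _     ≈⟨ +-congʳ (*-congʳ (eval-trivial em K (col 0) (ι (suc N ℕ.+ T)) ¬any)) ⟨
      _                                 ≈⟨ zeros n Z≤n T ⟩
      0#                                ∎

  D-finite⇒periodic : ∀ n → NontrivialSpan (iterate θ series n) 𝟎 → EventuallyPeriodic w
  D-finite⇒periodic d nt with nontrivial⇒operator d series nt
  ... | O , nonzero = determined⇒periodic Z (proj₁ det) (proj₂ det)
    where
    N = bound O
    e : ℕ → ℕ → Carrier
    e s t = eval (column O s) (ι t)

    Z = proj₁ (recurrent N)

    -- Every n′ whose window agrees with that of n is a root of windowSum e N n.
    zeros : ∀ n → Z ℕ.≤ n → ∀ T → windowSum e N n T ≈ 0#
    zeros n Z≤n = manyRoots⇒zero d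
      (degree-windowSum d N n λ s → ≡.subst (λ k → Degree< k (e s)) (length-column O s) (degree-eval (column O s)))
      λ m → let n′ , m≤n′ , agree = proj₂ (recurrent N) n Z≤n m in n′ , m≤n′ , (begin
        windowSum e N n n′          ≈⟨ windowSum-local e N n′ agree ⟨
        windowSum e N n′ n′         ≈⟨ convolve-windowSum N e n′ (vanishing O) ⟨
        convolve e series (N ℕ.+ n′) ≈⟨ acts O (N ℕ.+ n′) ⟨
        0#                          ∎)

    det = determined Z N (column O) (vanishing O) nonzero zeros

-- Reduction from Laurent series to power series, and closed forms.

module LaurentSeriesOver (em : ExcludedMiddle 0ℓ) (K : CommutativeRing 0ℓ 0ℓ) (isDomain : IsCharZeroDomain K) where
  open CommutativeRing K hiding (zero)
  open PowerSeries K
  open LaurentSeries rawRing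
  open Laurent
  open IntegerSolver K
  open SetoidReasoning setoid
  private
    module P  = CommutativeRing seriesRing
    module PS = IntegerSolver seriesRing
    module PR = SetoidReasoning P.setoid
    module PD = IsCharZeroDomain (series-isDomain em isDomain)
    module PP = IsSubring polynomial-isSubring
    module L  = RawRing laurentRing
    module AK = Algebraicity rawRing
    module AP = Algebraicity P.rawRing
    module AL = Algebraicity laurentRing
  open RawSemiringDefs L.rawSemiring using (_^_)

  ξ : Series
  ξ = coeffs X

  ξ-⊛ : ∀ f → ξ ⊛ f ≋ shift 1 f
  ξ-⊛ f zero    = solve 1 (λ y → con ℤ.0ℤ :* y :+ con ℤ.0ℤ := con ℤ.0ℤ) refl (f 0)
  ξ-⊛ f (suc n) = begin
    0# * f (suc n) + ((ξ ∘ suc) ⊛ f) n  ≈⟨ solve 2 (λ y z → con ℤ.0ℤ :* y :+ z := z) refl (f (suc n)) _ ⟩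
    ((ξ ∘ suc) ⊛ f) n                   ≈⟨ ⊛-cong {ξ ∘ suc} {𝟏} {f} (λ { zero → refl ; (suc _) → refl }) (λ _ → refl) n ⟩
    (𝟏 ⊛ f) n                           ≈⟨ ⊛-identityˡ f n ⟩
    f n                                 ∎

  shift-⊛ʳ : ∀ k f g → f ⊛ shift k g ≋ shift k (f ⊛ g)
  shift-⊛ʳ k f g = PR.begin
    f ⊛ shift k g         PR.≈⟨ P.*-congˡ {f} (shift-⊛ k g) ⟩
    f ⊛ (shift k 𝟏 ⊛ g)   PR.≈⟨ PS.solve 3 (λ f x g → f PS.:* (x PS.:* g) PS.:= x PS.:* (f PS.:* g)) P.refl f (shift k 𝟏) g ⟩
    shift k 𝟏 ⊛ (f ⊛ g)   PR.≈⟨ shift-⊛ k (f ⊛ g) ⟨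
    shift k (f ⊛ g)       PR.∎

  shift-⊕ : ∀ k f g → shift k (f ⊕ g) ≋ shift k f ⊕ shift k g
  shift-⊕ zero    f g n       = refl
  shift-⊕ (suc k) f g zero    = sym (+-identityˡ 0#)
  shift-⊕ (suc k) f g (suc n) = shift-⊕ k f g n

  shift-+ : ∀ k f n → shift k f (k ℕ.+ n) ≡ f n
  shift-+ zero    f n = ≡.refl
  shift-+ (suc k) f n = shift-+ k f n

  unshift-isPolynomial : ∀ k {f} → IsPolynomial (shift k f) → IsPolynomial f
  unshift-isPolynomial k {f} (N , eq) = N , λ n N≤n →
    trans (reflexive (≡.sym (shift-+ k f n))) (eq (k ℕ.+ n) (ℕₚ.≤-trans N≤n (ℕₚ.m≤n+m n k)))

  shift-≉0 : ∀ k {f} → ¬ (f ≋ 𝟎) → ¬ (shift k f ≋ 𝟎)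
  shift-≉0 k f≉0 eq = f≉0 (shift-injective k (P.trans eq (P.sym (shift-zero k (P.refl {𝟎})))))

  constant-0 : constant 0# ≋ 𝟎
  constant-0 zero    = refl
  constant-0 (suc n) = refl

  ≈0⇒coeffs≋0 : ∀ {F} → F L.≈ L.0# → coeffs F ≋ 𝟎
  ≈0⇒coeffs≋0 {F} eq n = trans (eq n) (shift-zero (pole F) constant-0 n)

  coeffs≋0⇒≈0 : ∀ {F} → coeffs F ≋ 𝟎 → F L.≈ L.0#
  coeffs≋0⇒≈0 {F} eq n = trans (eq n) (sym (shift-zero (pole F) constant-0 n))

  -- Applied to `coeffs F`, with the pole left out: this changes `F` only by a power of `X`, which
  -- is itself a polynomial.
  IsRationalSeries : Pred Series 0ℓ
  IsRationalSeries c = ∃[ b ] (IsPolynomial b × ¬ (b ≋ 𝟎) × IsPolynomial (b ⊛ c))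

  rational-shift : ∀ k {c} → IsRationalSeries c → IsRationalSeries (shift k c)
  rational-shift k {c} (b , pb , b≉0 , pbc) = b , pb , b≉0 ,
    PP.resp (P.sym (shift-⊛ʳ k b c)) (shift-isPolynomial k pbc)

  evalX-isPolynomial : ∀ ks → IsPolynomial (coeffs (AL.eval (map const ks) X))
  evalX-isPolynomial []       = constant-isPolynomial 0#
  evalX-isPolynomial (k ∷ ks) = PP.+-closed
    (shift-isPolynomial (pole (AL.eval (map const ks) X)) (constant-isPolynomial k))
    (PP.resp (P.sym (ξ-⊛ _)) (shift-isPolynomial 1 (evalX-isPolynomial ks)))

  evalX⇒polynomial : ∀ F ks → F L.≈ AL.eval (map const ks) X → IsPolynomial (coeffs F)
  evalX⇒polynomial F ks F≈E = unshift-isPolynomial (pole (AL.eval (map const ks) X))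
    (PP.resp (λ n → sym (F≈E n)) (shift-isPolynomial (pole F) (evalX-isPolynomial ks)))

  quotient⇒rational : ∀ {F A B} → IsPolynomial (coeffs A) → IsPolynomial (coeffs B) →
                      F AL.≈ A / B → IsRationalSeries (coeffs F)
  quotient⇒rational {F} {A} {B} pA pB (B≉0 , eq) =
    shift r b , shift-isPolynomial r pB ,
    shift-≉0 r (λ z → B≉0 (coeffs≋0⇒≈0 {B} z)) ,
    PP.resp (P.sym key) (shift-isPolynomial (pole F ℕ.+ pole B) pA)
    where
    r = pole A
    b = coeffs B
    c = coeffs F
    key : shift r b ⊛ c ≋ shift (pole F ℕ.+ pole B) (coeffs A)
    key = PR.begin
      shift r b ⊛ c                         PR.≈⟨ P.*-comm (shift r b) c ⟩
      c ⊛ shift r b                         PR.≈⟨ shift-⊛ʳ r c b ⟩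
      shift r (c ⊛ b)                       PR.≈⟨ eq ⟩
      shift (pole F ℕ.+ pole B) (coeffs A)  PR.∎

  module _ (g : Series) where
    private
      E : List Laurent → Laurent
      E ks = AL.eval ks (powerSeries g)

    -- the coefficients of the polynomial ks multiplied by the power of X that clears all poles
    flatten : List Laurent → List Series
    flatten []       = []
    flatten (k ∷ ks) = shift (pole (E ks)) (coeffs k) ∷ map (shift (pole k)) (flatten ks)

    eval-map-shift : ∀ p hs → AP.eval (map (shift p) hs) g ≋ shift p (AP.eval hs g)
    eval-map-shift p []       n = sym (shift-zero p (λ _ → refl) n)
    eval-map-shift p (h ∷ hs) n = begin
      shift p h n + (g ⊛ AP.eval (map (shift p) hs) g) n ≈⟨ +-congˡ (P.*-congˡ {g} (eval-map-shift p hs) n) ⟩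
      shift p h n + (g ⊛ shift p (AP.eval hs g)) n       ≈⟨ +-congˡ (shift-⊛ʳ p g (AP.eval hs g) n) ⟩
      shift p h n + shift p (g ⊛ AP.eval hs g) n         ≈⟨ shift-⊕ p h (g ⊛ AP.eval hs g) n ⟨
      shift p (h ⊕ (g ⊛ AP.eval hs g)) n                 ∎

    eval-flatten : ∀ ks → coeffs (E ks) ≋ AP.eval (flatten ks) g
    eval-flatten []       n = constant-0 n
    eval-flatten (k ∷ ks) n = +-congˡ (begin
      shift (pole k) (g ⊛ coeffs (E ks)) n                   ≈⟨ shift-⊛ʳ (pole k) g (coeffs (E ks)) n ⟨
      (g ⊛ shift (pole k) (coeffs (E ks))) n                 ≈⟨ P.*-congˡ {g} (shift-cong (pole k) (eval-flatten ks)) n ⟩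
      (g ⊛ shift (pole k) (AP.eval (flatten ks) g)) n        ≈⟨ P.*-congˡ {g} (eval-map-shift (pole k) (flatten ks)) n ⟨
      (g ⊛ AP.eval (map (shift (pole k)) (flatten ks)) g) n  ∎)

    flatten-Any : ∀ {ks} → Any (L._≉ L.0#) ks → Any (P._≉ 𝟎) (flatten ks)
    flatten-Any {k ∷ ks} (here k≉0)  = here (shift-≉0 (pole (E ks)) (λ z → k≉0 (coeffs≋0⇒≈0 {k} z)))
    flatten-Any {k ∷ ks} (there any) = there (Anyₚ.map⁺ (Any.map (shift-≉0 (pole k)) (flatten-Any any)))

    flatten-All : ∀ {ks} → All (IsRationalSeries ∘ coeffs) ks → All IsRationalSeries (flatten ks)
    flatten-All []                  = []
    flatten-All {k ∷ ks} (rk ∷ rks) = rational-shift (pole (E ks)) rk ∷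
      Allₚ.map⁺ (All.map (rational-shift (pole k)) (flatten-All rks))

    clearDenominators : ∀ {hs} → All IsRationalSeries hs →
      ∃[ d ] (IsPolynomial d × ¬ (d ≋ 𝟎) × All (IsPolynomial ∘ (d ⊛_)) hs)
    clearDenominators [] = 𝟏 , PP.1-closed , PD.1≉0 , []
    clearDenominators {h ∷ hs} ((b , pb , b≉0 , pbh) ∷ rs) with clearDenominators rs
    ... | d , pd , d≉0 , all = b ⊛ d , PP.*-closed pb pd , PD.*-≉0 b≉0 d≉0 ,
      PP.resp (PS.solve 3 (λ d b h → d PS.:* (b PS.:* h) PS.:= (b PS.:* d) PS.:* h) P.refl d b h) (PP.*-closed pd pbh)
      ∷ All.map (λ {x} p → PP.resp (P.sym (P.*-assoc b d x)) (PP.*-closed pb p)) all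

    eval-scaled : ∀ d hs → AP.eval (map (d ⊛_) hs) g ≋ d ⊛ AP.eval hs g
    eval-scaled d []       = P.sym (P.zeroʳ d)
    eval-scaled d (h ∷ hs) = P.trans (P.+-congˡ {d ⊛ h} (P.*-congˡ {g} (eval-scaled d hs)))
      (PS.solve 4 (λ d h g e → d PS.:* h PS.:+ g PS.:* (d PS.:* e) PS.:= d PS.:* (h PS.:+ g PS.:* e)) P.refl d h g (AP.eval hs g))

    -- The annihilating polynomial is multiplied by a power of `X` to clear poles (`flatten`) and by
    -- a common denominator `d`. Both factors are nonzero, so a nonzero coefficient survives in the
    -- domain.
    laurent⇒series-algebraic : ∀ {Q : Pred Laurent 0ℓ} → (∀ {F} → Q F → IsRationalSeries (coeffs F)) →
      AL.AlgebraicOver Q (powerSeries g) → AP.AlgebraicOver IsPolynomial g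
    laurent⇒series-algebraic rat (ks , Qks , any , eq) with clearDenominators (flatten-All (All.map rat Qks))
    ... | d , pd , d≉0 , all = map (d ⊛_) (flatten ks) , Allₚ.map⁺ all ,
      Anyₚ.map⁺ (Any.map (PD.*-≉0 d≉0) (flatten-Any any)) , (PR.begin
        AP.eval (map (d ⊛_) (flatten ks)) g  PR.≈⟨ eval-scaled d (flatten ks) ⟩
        d ⊛ AP.eval (flatten ks) g           PR.≈⟨ P.*-congˡ {d} (eval-flatten ks) ⟨
        d ⊛ coeffs (E ks)                    PR.≈⟨ P.*-congˡ {d} (≈0⇒coeffs≋0 {E ks} eq) ⟩
        d ⊛ 𝟎                                PR.≈⟨ P.zeroʳ d ⟩
        𝟎                                    PR.∎)

  Δ : Series
  Δ = 𝟏 ⊕ P.- ξ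

  Δ-⊛ : ∀ f → f ⊛ Δ ≋ f ⊕ P.- shift 1 f
  Δ-⊛ f = P.trans
    (PS.solve 2 (λ f x → f PS.:* (PS.con ℤ.1ℤ PS.:- x) PS.:= f PS.:- x PS.:* f) P.refl f ξ)
    (P.+-congˡ {f} (P.-‿cong (ξ-⊛ f)))

  Δ-≉0 : ¬ (Δ ≋ 𝟎)
  Δ-≉0 eq = 1≉0 (trans (solve 0 (con ℤ.1ℤ := con ℤ.1ℤ :- con ℤ.0ℤ) refl) (eq 0))
    where open IsCharZeroDomain isDomain

  -- Multiplication by `1 - X` takes differences of consecutive coefficients, which recovers the
  -- tile lengths from the endpoints.
  summation : ∀ {t f : Series} → t 0 ≈ 0# → (∀ n → t (suc n) ≈ t n + f n) → t ⊛ Δ ≋ ξ ⊛ f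
  summation {t} {f} t₀ t₊ = P.trans (Δ-⊛ t) (P.trans step (P.sym (ξ-⊛ f)))
    where
    step : t ⊕ P.- shift 1 t ≋ shift 1 f
    step zero    = trans (+-congʳ t₀) (-‿inverseʳ 0#)
    step (suc n) = trans (+-congʳ (t₊ n)) (solve 2 (λ t f → (t :+ f) :- t := f) refl (t n) (f n))

  -- For `c = 1` this exhibits the inverse of `Δ`, with which `periodicForm` divides by `1 - X`.
  geometric : ∀ c → (λ _ → c) ⊛ Δ ≋ constant c
  geometric c = P.trans (Δ-⊛ (λ _ → c)) λ
    { zero → solve 1 (λ c → c :- con ℤ.0ℤ := c) refl c ; (suc n) → -‿inverseʳ c }

  Δ²-≉0 : (L.1# L.+ L.- X) ^ 2 L.≉ L.0#
  Δ²-≉0 eq = PD.*-≉0 Δ-≉0 (PD.*-≉0 Δ-≉0 PD.1≉0) (≈0⇒coeffs≋0 {(L.1# L.+ L.- X) ^ 2} eq)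

  arithmeticProgression : ∀ {t : Series} c → t 0 ≈ 0# → (∀ n → t (suc n) ≈ t n + c) →
    powerSeries t AL.≈ (const c L.* X) / ((L.1# L.+ L.- X) ^ 2)
  arithmeticProgression {t} c t₀ t₊ = Δ²-≉0 , (PR.begin
    t ⊛ (Δ ⊛ (Δ ⊛ 𝟏))          PR.≈⟨ PS.solve 2 (λ t d → t PS.:* (d PS.:* (d PS.:* PS.con ℤ.1ℤ)) PS.:= (t PS.:* d) PS.:* d) P.refl t Δ ⟩
    (t ⊛ Δ) ⊛ Δ                PR.≈⟨ P.*-congʳ {Δ} (summation t₀ t₊) ⟩
    (ξ ⊛ (λ _ → c)) ⊛ Δ        PR.≈⟨ P.*-assoc ξ (λ _ → c) Δ ⟩
    ξ ⊛ ((λ _ → c) ⊛ Δ)        PR.≈⟨ P.*-congˡ {ξ} (geometric c) ⟩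
    ξ ⊛ constant c             PR.≈⟨ P.*-comm ξ (constant c) ⟩
    constant c ⊛ ξ             PR.∎)

  private
    -- The pole of an `eval` over a computed list is `0` only propositionally. Abstracting that
    -- value to `F` allows the equation to be matched, after which the shifts by the pole compute
    -- away.
    evalX-cons : ∀ {f} (F : Laurent) → pole F ≡ 0 → coeffs F ≋ (f ∘ suc) →
                 pole (const (f 0) L.+ X L.* F) ≡ 0 × coeffs (const (f 0) L.+ X L.* F) ≋ f
    evalX-cons {f} (.0 , c) ≡.refl eq = ≡.refl , λ n → trans (+-congˡ (ξ-⊛ c n)) (case n)
      where
      case : ∀ n → constant (f 0) n + shift 1 c n ≈ f n
      case zero    = +-identityʳ _
      case (suc n) = trans (+-identityˡ _) (eq n)

  evalX-applyUpTo : ∀ N f → (∀ n → N ℕ.≤ n → f n ≈ 0#) →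
    let F = AL.eval (map const (applyUpTo f N)) X in pole F ≡ 0 × coeffs F ≋ f
  evalX-applyUpTo zero    f f≈0 = ≡.refl , λ n → trans (constant-0 n) (sym (f≈0 n ℕ.z≤n))
  evalX-applyUpTo (suc N) f f≈0 =
    let p , eq = evalX-applyUpTo N (f ∘ suc) (λ n le → f≈0 (suc n) (ℕ.s≤s le))
    in evalX-cons (AL.eval (map const (applyUpTo (f ∘ suc) N)) X) p eq

  polynomial⇒evalX : ∀ N {f} → (∀ n → N ℕ.≤ n → f n ≈ 0#) →
                     powerSeries f L.≈ AL.eval (map const (applyUpTo f N)) X
  polynomial⇒evalX N {f} f≈0 = convert (AL.eval (map const (applyUpTo f N)) X) (evalX-applyUpTo N f f≈0)
    where
    convert : ∀ F → pole F ≡ 0 × coeffs F ≋ f → powerSeries f L.≈ F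
    convert (.0 , c) (≡.refl , eq) n = sym (eq n)

  X^ : ∀ d → pole (X ^ d) ≡ 0 × coeffs (X ^ d) ≋ shift d 𝟏
  X^ zero    = ≡.refl , λ _ → refl
  X^ (suc d) with X^ d
  ... | p , eq = p , P.trans (P.*-congˡ {ξ} eq) (P.trans (ξ-⊛ (shift d 𝟏)) λ { zero → refl ; (suc n) → refl })

  module _ where
    open IsCharZeroDomain isDomain

    -- `1# + 0#` is the unfolding of `fromℤ` at one, the denominator of the rationals `0`, `1` and
    -- `-1`.
    1+0≉0 : 1# + 0# ≉ 0#
    1+0≉0 eq = 1≉0 (trans (sym (+-identityʳ 1#)) eq)

    rational-resp : ∀ {x y} → x ≈ y → AK.Rational x → AK.Rational y
    rational-resp x≈y (q , q≉0 , eq) = q , q≉0 , trans (*-congʳ (sym x≈y)) eq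

    rational-0 : AK.Rational 0#
    rational-0 = ℚ.0ℚ , 1+0≉0 , zeroˡ _

    rational-1 : AK.Rational 1#
    rational-1 = ℚ.1ℚ , 1+0≉0 , *-identityˡ _

    rational-neg : AK.Rational (- 1#)
    rational-neg = ℚ.- ℚ.1ℚ , 1+0≉0 ,
      solve 0 ((:- con ℤ.1ℤ) :* (con ℤ.1ℤ :+ con ℤ.0ℤ) := :- (con ℤ.1ℤ :+ con ℤ.0ℤ)) refl

  -- The closed form for eventually periodic words.

  module _ (w : InfiniteWord) (value : Letter → Carrier) (δ : Carrier) (δ≈ : δ ≈ value a₁ - value a₂) where

    -- Marking `a₂` gives `value a = value a₁ - δ * indicator a`, in line with the base length
    -- `value a₁` of the formula; the minus sign goes into `P`.
    indicator : Letter → Carrier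
    indicator a₁ = 0#
    indicator a₂ = 1#

    W U : Series
    W = indicator ∘ w
    U _ = 1#

    letters : value ∘ w ≋ (constant (value a₁) ⊛ U) ⊕ P.- (constant δ ⊛ W)
    letters n = trans (byLetter (w n))
      (sym (+-cong (⊛-constantˡ (value a₁) U n) (-‿cong (⊛-constantˡ δ W n))))
      where
      byLetter : ∀ a → value a ≈ value a₁ * 1# - δ * indicator a
      byLetter a₁ = solve 2 (λ v d → v := v :* con ℤ.1ℤ :- d :* con ℤ.0ℤ) refl (value a₁) δ
      byLetter a₂ = trans (solve 2 (λ v u → u := v :* con ℤ.1ℤ :- (v :- u) :* con ℤ.1ℤ) refl (value a₁) (value a₂))
        (+-congˡ (-‿cong (*-congʳ (sym δ≈))))

    IsBit : Pred Carrier 0ℓ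
    IsBit x = x ≈ 0# ⊎ x ≈ 1#

    W-bit : ∀ n → IsBit (W n)
    W-bit n with w n
    ... | a₁ = inj₁ refl
    ... | a₂ = inj₂ refl

    shift-bit : ∀ k {f} → (∀ n → IsBit (f n)) → ∀ n → IsBit (shift k f n)
    shift-bit zero    b n       = b n
    shift-bit (suc k) b zero    = inj₁ refl
    shift-bit (suc k) b (suc n) = shift-bit k b n

    -- The coefficients of `P` are differences of bits, hence among `0`, `1` and `-1`; this makes
    -- `P` rational even when the lengths are not.
    bit-difference : ∀ {x y} → IsBit x → IsBit y → AK.Rational (y - x)
    bit-difference (inj₁ x≈0) (inj₁ y≈0) = rational-resp
      (sym (trans (+-cong y≈0 (-‿cong x≈0)) (-‿inverseʳ 0#))) rational-0
    bit-difference (inj₂ x≈1) (inj₂ y≈1) = rational-resp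
      (sym (trans (+-cong y≈1 (-‿cong x≈1)) (-‿inverseʳ 1#))) rational-0
    bit-difference (inj₁ x≈0) (inj₂ y≈1) = rational-resp
      (sym (trans (+-cong y≈1 (-‿cong x≈0)) (solve 0 (con ℤ.1ℤ :- con ℤ.0ℤ := con ℤ.1ℤ) refl))) rational-1
    bit-difference (inj₂ x≈1) (inj₁ y≈0) = rational-resp
      (sym (trans (+-cong y≈0 (-‿cong x≈1)) (+-identityˡ (- 1#)))) rational-neg

    -- The numerator is P = −(1 − X^d) Σ_{w_n = a₂} Xⁿ.
    periodicForm : ∀ {t : Series} → t 0 ≈ 0# → (∀ n → t (suc n) ≈ t n + value (w n)) → EventuallyPeriodic w →
      ∃[ P ] ∃[ d ] ((∃[ ks ] (All AK.Rational ks × P L.≈ AL.eval (map const ks) X)) × 1 ℕ.≤ d ×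
        ∃[ Q₁ ] ∃[ Q₂ ]
          ( Q₁ AL.≈ (X L.* P) / ((L.1# L.+ L.- X) L.* (L.1# L.+ L.- (X ^ d)))
          × Q₂ AL.≈ X / ((L.1# L.+ L.- X) ^ 2)
          × powerSeries t L.≈ const δ L.* Q₁ L.+ const (value a₁) L.* Q₂ ))
    periodicForm {t} t₀ t₊ (N , d@(suc d′) , 1≤d , periodic) =
      powerSeries p , d ,
      (applyUpTo p (N ℕ.+ d) , Allₚ.applyUpTo⁺₂ p (N ℕ.+ d) (λ n → bit-difference (W-bit n) (shift-bit d W-bit n)) , polynomial⇒evalX (N ℕ.+ d) p≈0) ,
      1≤d , powerSeries q₁ , powerSeries q₂ ,
      quotient (X ^ d) (X^ d) , (Δ²-≉0 , Q₂-eq) , t≋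
      where
      p q₁ q₂ : Series
      p n = shift d W n - W n
      -- The factor `1 - X^d` of `P` cancels in the first fraction and leaves `-X W / (1 - X)`,
      -- where `U` is `1 / (1 - X)`.
      q₁ = P.- (ξ ⊛ (U ⊛ W))
      q₂ = ξ ⊛ (U ⊛ U)

      -- The coefficient compares the positions `n ∸ d` and `n`, and periodicity requires the
      -- smaller one to be at least `N`.
      p≈0 : ∀ n → N ℕ.+ d ℕ.≤ n → p n ≈ 0#
      p≈0 n le = ≡.subst (λ n → p n ≈ 0#) (ℕₚ.m+[n∸m]≡n d≤n) (begin
        shift d W (d ℕ.+ m) - W (d ℕ.+ m)
          ≡⟨ ≡.cong₂ (λ x y → x - indicator y) (shift-+ d W m) (≡.trans (≡.cong w (ℕₚ.+-comm d m)) (periodic m N≤m)) ⟩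
        W m - W m ≈⟨ -‿inverseʳ (W m) ⟩
        0# ∎)
        where
        d≤n : d ℕ.≤ n
        d≤n = ℕₚ.≤-trans (ℕₚ.m≤n+m d N) le
        m = n ∸ d
        N≤m : N ℕ.≤ m
        N≤m = ≡.subst (ℕ._≤ m) (ℕₚ.m+n∸n≡m N d) (ℕₚ.∸-monoˡ-≤ d le)

      UΔ : U ⊛ Δ ≋ 𝟏
      UΔ = geometric 1#

      Q₂-eq : q₂ ⊛ (Δ ⊛ (Δ ⊛ 𝟏)) ≋ ξ
      Q₂-eq = PR.begin
        q₂ ⊛ (Δ ⊛ (Δ ⊛ 𝟏))
          PR.≈⟨ PS.solve 3 (λ x u d → (x PS.:* (u PS.:* u)) PS.:* (d PS.:* (d PS.:* PS.con ℤ.1ℤ)) PS.:= x PS.:* ((u PS.:* d) PS.:* (u PS.:* d))) P.refl ξ U Δ ⟩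
        ξ ⊛ ((U ⊛ Δ) ⊛ (U ⊛ Δ))  PR.≈⟨ P.*-congˡ {ξ} (P.*-cong UΔ UΔ) ⟩
        ξ ⊛ (𝟏 ⊛ 𝟏)              PR.≈⟨ PS.solve 1 (λ x → x PS.:* (PS.con ℤ.1ℤ PS.:* PS.con ℤ.1ℤ) PS.:= x) P.refl ξ ⟩
        ξ                        PR.∎

      -- `X ^ d` is generalised to `Y` so that the equation for its pole, which holds by induction
      -- on `d`, can be matched.
      quotient : ∀ Y → pole Y ≡ 0 × coeffs Y ≋ shift d 𝟏 →
        powerSeries q₁ AL.≈ (X L.* powerSeries p) / ((L.1# L.+ L.- X) L.* (L.1# L.+ L.- Y))
      quotient (.0 , y) (≡.refl , y≋) =
        (λ eq → PD.*-≉0 Δ-≉0 1-y≉0 (≈0⇒coeffs≋0 {(L.1# L.+ L.- X) L.* (L.1# L.+ L.- (0 , y))} eq)) , (PR.begin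
          q₁ ⊛ (Δ ⊛ (𝟏 ⊕ P.- y))
            PR.≈⟨ PS.solve 5 (λ x u v d y → (PS.:- (x PS.:* (u PS.:* v))) PS.:* (d PS.:* (PS.con ℤ.1ℤ PS.:- y))
                                       PS.:= (u PS.:* d) PS.:* (x PS.:* (y PS.:* v PS.:- v))) P.refl ξ U W Δ y ⟩
          (U ⊛ Δ) ⊛ (ξ ⊛ (y ⊛ W ⊕ P.- W))
            PR.≈⟨ P.*-cong UΔ (P.*-congˡ {ξ} (P.+-congʳ {P.- W} (P.trans (P.*-congʳ {W} y≋) (P.sym (shift-⊛ d W))))) ⟩
          𝟏 ⊛ (ξ ⊛ p) PR.≈⟨ P.*-identityˡ (ξ ⊛ p) ⟩
          ξ ⊛ p PR.∎)
        where
        1-y≉0 : ¬ (𝟏 ⊕ P.- y ≋ 𝟎)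
        1-y≉0 eq = IsCharZeroDomain.1≉0 isDomain (begin
          1#        ≈⟨ solve 0 (con ℤ.1ℤ := con ℤ.1ℤ :- con ℤ.0ℤ) refl ⟩
          1# - 0#   ≈⟨ +-congˡ (-‿cong (y≋ 0)) ⟨
          1# - y 0  ≈⟨ eq 0 ⟩
          0#        ∎)

      t≋ : t ≋ (constant δ ⊛ q₁) ⊕ (constant (value a₁) ⊛ q₂)
      t≋ = PR.begin
        t                    PR.≈⟨ P.*-identityʳ t ⟨
        t ⊛ 𝟏                PR.≈⟨ P.*-congˡ {t} UΔ ⟨
        t ⊛ (U ⊛ Δ)          PR.≈⟨ PS.solve 3 (λ t u d → t PS.:* (u PS.:* d) PS.:= (t PS.:* d) PS.:* u) P.refl t U Δ ⟩
        (t ⊛ Δ) ⊛ U          PR.≈⟨ P.*-congʳ {U} (summation t₀ t₊) ⟩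
        (ξ ⊛ (value ∘ w)) ⊛ U PR.≈⟨ P.*-congʳ {U} (P.*-congˡ {ξ} letters) ⟩
        (ξ ⊛ ((constant (value a₁) ⊛ U) ⊕ P.- (constant δ ⊛ W))) ⊛ U
          PR.≈⟨ PS.solve 5 (λ x v u d y → (x PS.:* (v PS.:* u PS.:- d PS.:* y)) PS.:* u
                    PS.:= d PS.:* (PS.:- (x PS.:* (u PS.:* y))) PS.:+ v PS.:* (x PS.:* (u PS.:* u)))
                  P.refl ξ (constant (value a₁)) U (constant δ) W ⟩
        (constant δ ⊛ q₁) ⊕ (constant (value a₁) ⊛ q₂) PR.∎

  module _ (w : InfiniteWord) (value : Letter → Carrier) where

    algebraic⇒periodic : (∀ {x y} → value x ≈ value y → x ≡ y) →
      ∀ {t : Series} → t 0 ≈ 0# → (∀ n → t (suc n) ≈ t n + value (w n)) →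
      ∀ {Q : Pred Laurent 0ℓ} → (∀ {F} → Q F → IsRationalSeries (coeffs F)) →
      AL.AlgebraicOver Q (powerSeries t) → EventuallyPeriodic w
    algebraic⇒periodic value-injective {t} t₀ t₊ rat alg = D-finite⇒periodic (proj₁ D-finite) (proj₂ D-finite)
      where
      open FiniteAlphabet em K isDomain w value value-injective
      open AlgebraicElement em seriesRing (series-isDomain em isDomain) IsPolynomial polynomial-isSubring t
      ξ-polynomial : IsPolynomial ξ
      ξ-polynomial = 2 , λ { (suc zero) (ℕ.s≤s ()) ; (suc (suc n)) _ → refl }

      ξ≉0 : ¬ (ξ ≋ 𝟎)
      ξ≉0 eq = IsCharZeroDomain.1≉0 isDomain (eq 1)

      -- The multipliers are `X` and `1 - X`: by `summation`, `X` times the letter series equals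
      -- `1 - X` times the endpoint series.
      D-finite = algebraic⇒D-finite θ θ-isDerivation θ-polynomial (laurent⇒series-algebraic t rat alg)
        ξ-polynomial ξ≉0 (PP.+-closed PP.1-closed (PP.-‿closed ξ-polynomial))
        (P.trans (P.sym (summation t₀ t₊)) (P.*-comm t Δ))

-- The complex numbers as a domain of characteristic zero.

module ComplexNumbers (em : ExcludedMiddle 0ℓ) (ℝ : CompleteOrderedField) where
  open CompleteOrderedField ℝ hiding (zero)
  open IsTotalOrder isTotalOrder using (antisym; total) renaming (reflexive to ≤-reflexive; trans to ≤-trans)
  open SemiringMultiples semiring using () renaming (_×_ to _·_)
  open IntegerSolver commutativeRing
  open SetoidReasoning setoid
  private module ℂ = RawRing (Realisation.ℂ ℝ)

  ≤-resp : ∀ {x y x′ y′} → x ≈ x′ → y ≈ y′ → x ≤ y → x′ ≤ y′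
  ≤-resp x≈ y≈ x≤y = ≤-trans (≤-reflexive (sym x≈)) (≤-trans x≤y (≤-reflexive y≈))

  x≤x+y : ∀ x {y} → 0# ≤ y → x ≤ x + y
  x≤x+y x {y} 0≤y = ≤-resp (+-identityˡ x) (+-comm y x) (+-monoˡ-≤ x 0≤y)

  0≤x² : ∀ x → 0# ≤ x * x
  0≤x² x with total 0# x
  ... | inj₁ 0≤x = *-nonNeg 0≤x 0≤x
  ... | inj₂ x≤0 = ≤-resp refl (solve 1 (λ x → (:- x) :* (:- x) := x :* x) refl x) (*-nonNeg 0≤-x 0≤-x)
    where
    0≤-x : 0# ≤ - x
    0≤-x = ≤-resp (-‿inverseʳ x) (+-identityˡ (- x)) (+-monoˡ-≤ (- x) x≤0)

  ℝ-noZeroDivisors : ∀ {x y} → x * y ≈ 0# → x ≈ 0# ⊎ y ≈ 0#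
  ℝ-noZeroDivisors {x} {y} xy≈0 with em {x ≈ 0#}
  ... | yes x≈0 = inj₁ x≈0
  ... | no x≉0 with inverse x x≉0
  ...   | z , xz≈1 = inj₂ (begin
    y            ≈⟨ *-identityˡ y ⟨
    1# * y       ≈⟨ *-congʳ xz≈1 ⟨
    x * z * y    ≈⟨ solve 3 (λ x z y → x :* z :* y := z :* (x :* y)) refl x z y ⟩
    z * (x * y)  ≈⟨ *-congˡ xy≈0 ⟩
    z * 0#       ≈⟨ zeroʳ z ⟩
    0#           ∎)

  0≤·1 : ∀ n → 0# ≤ n · 1#
  0≤·1 zero    = ≤-reflexive refl
  0≤·1 (suc n) = ≤-trans (≤-resp refl (*-identityˡ 1#) (0≤x² 1#)) (x≤x+y 1# (0≤·1 n))

  -- `0 ≤ 1` because `1` is a square, and `1` is at most every positive multiple of itself; if such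
  -- a multiple were `0`, then `0` and `1` would coincide.
  ℝ-charZero : ∀ n → suc n · 1# ≉ 0#
  ℝ-charZero n eq = 0≉1 (antisym (≤-resp refl (*-identityˡ 1#) (0≤x² 1#)) (≤-resp refl eq (x≤x+y 1# (0≤·1 n))))

  -- `0 ≤ x² ≤ x² + y² = 0`. This makes a complex number of norm zero vanish.
  x²+y²≈0⇒x≈0 : ∀ {x y} → x * x + y * y ≈ 0# → x ≈ 0#
  x²+y²≈0⇒x≈0 {x} {y} eq with ℝ-noZeroDivisors (antisym (≤-resp refl eq (x≤x+y (x * x) (0≤x² y))) (0≤x² x))
  ... | inj₁ x≈0 = x≈0
  ... | inj₂ x≈0 = x≈0

  ℂ-ring : CommutativeRing 0ℓ 0ℓ
  ℂ-ring = record
    { Carrier = ℂ.Carrier ; _≈_ = ℂ._≈_ ; _+_ = ℂ._+_ ; _*_ = ℂ._*_ ; -_ = ℂ.-_ ; 0# = ℂ.0# ; 1# = ℂ.1#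
    ; isCommutativeRing = record
      { isRing = record
        { +-isAbelianGroup = record
          { isGroup = record
            { isMonoid = record
              { isSemigroup = record
                { isMagma = record
                  { isEquivalence = record
                    { refl = refl , refl
                    ; sym = λ { (p , q) → sym p , sym q }
                    ; trans = λ { (p , q) (p′ , q′) → trans p p′ , trans q q′ } }
                  ; ∙-cong = λ { (p , q) (p′ , q′) → +-cong p p′ , +-cong q q′ } }
                ; assoc = λ { (x , y) (u , v) (s , t) → +-assoc x u s , +-assoc y v t } }
              ; identity = (λ { (x , y) → +-identityˡ x , +-identityˡ y }) , (λ { (x , y) → +-identityʳ x , +-identityʳ y }) }
            ; inverse = (λ { (x , y) → -‿inverseˡ x , -‿inverseˡ y }) , (λ { (x , y) → -‿inverseʳ x , -‿inverseʳ y })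
            ; ⁻¹-cong = λ { (p , q) → -‿cong p , -‿cong q } }
          ; comm = λ { (x , y) (u , v) → +-comm x u , +-comm y v } }
        ; *-cong = λ { (p , q) (p′ , q′) →
            +-cong (*-cong p p′) (-‿cong (*-cong q q′)) , +-cong (*-cong p q′) (*-cong q p′) }
        ; *-assoc = λ { (x , y) (u , v) (s , t) →
            solve 6 (λ x y u v s t → (x :* u :- y :* v) :* s :- (x :* v :+ y :* u) :* t
                                  := x :* (u :* s :- v :* t) :- y :* (u :* t :+ v :* s)) refl x y u v s t ,
            solve 6 (λ x y u v s t → (x :* u :- y :* v) :* t :+ (x :* v :+ y :* u) :* s
                                  := x :* (u :* t :+ v :* s) :+ y :* (u :* s :- v :* t)) refl x y u v s t }
        ; *-identity =
            (λ { (x , y) → solve 2 (λ x y → con ℤ.1ℤ :* x :- con ℤ.0ℤ :* y := x) refl x y ,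
                           solve 2 (λ x y → con ℤ.1ℤ :* y :+ con ℤ.0ℤ :* x := y) refl x y }) ,
            (λ { (x , y) → solve 2 (λ x y → x :* con ℤ.1ℤ :- y :* con ℤ.0ℤ := x) refl x y ,
                           solve 2 (λ x y → x :* con ℤ.0ℤ :+ y :* con ℤ.1ℤ := y) refl x y })
        ; distrib =
            (λ { (x , y) (u , v) (s , t) →
              solve 6 (λ x y u v s t → x :* (u :+ s) :- y :* (v :+ t) := (x :* u :- y :* v) :+ (x :* s :- y :* t)) refl x y u v s t ,
              solve 6 (λ x y u v s t → x :* (v :+ t) :+ y :* (u :+ s) := (x :* v :+ y :* u) :+ (x :* t :+ y :* s)) refl x y u v s t }) ,
            (λ { (x , y) (u , v) (s , t) →
              solve 6 (λ x y u v s t → (u :+ s) :* x :- (v :+ t) :* y := (u :* x :- v :* y) :+ (s :* x :- t :* y)) refl x y u v s t ,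
              solve 6 (λ x y u v s t → (u :+ s) :* y :+ (v :+ t) :* x := (u :* y :+ v :* x) :+ (s :* y :+ t :* x)) refl x y u v s t })
        }
      ; *-comm = λ { (x , y) (u , v) →
          solve 4 (λ x y u v → x :* u :- y :* v := u :* x :- v :* y) refl x y u v ,
          solve 4 (λ x y u v → x :* v :+ y :* u := u :* y :+ v :* x) refl x y u v }
      }
    }

  ℂ-isDomain : IsCharZeroDomain ℂ-ring
  ℂ-isDomain = record { noZeroDivisors = nzd ; charZero = λ n eq → ℝ-charZero n (trans (sym (real (suc n))) (proj₁ eq)) }
    where
    open SemiringMultiples (CommutativeRing.semiring ℂ-ring) using () renaming (_×_ to _·ℂ_)

    real : ∀ n → proj₁ (n ·ℂ ℂ.1#) ≈ n · 1#
    real zero    = refl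
    real (suc n) = +-congˡ (real n)

    -- the norm is multiplicative
    nzd : ∀ {z z′} → z ℂ.* z′ ℂ.≈ ℂ.0# → z ℂ.≈ ℂ.0# ⊎ z′ ℂ.≈ ℂ.0#
    nzd {x , y} {u , v} (re , im) with ℝ-noZeroDivisors norm
      where
      norm : (x * x + y * y) * (u * u + v * v) ≈ 0#
      norm = begin
        (x * x + y * y) * (u * u + v * v)
          ≈⟨ solve 4 (λ x y u v → (x :* x :+ y :* y) :* (u :* u :+ v :* v)
               := (x :* u :- y :* v) :* (x :* u :- y :* v) :+ (x :* v :+ y :* u) :* (x :* v :+ y :* u)) refl x y u v ⟩
        (x * u - y * v) * (x * u - y * v) + (x * v + y * u) * (x * v + y * u)
          ≈⟨ +-cong (*-cong re re) (*-cong im im) ⟩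
        0# * 0# + 0# * 0# ≈⟨ solve 0 (con ℤ.0ℤ :* con ℤ.0ℤ :+ con ℤ.0ℤ :* con ℤ.0ℤ := con ℤ.0ℤ) refl ⟩
        0# ∎
    ... | inj₁ eq = inj₁ (x²+y²≈0⇒x≈0 eq , x²+y²≈0⇒x≈0 (trans (+-comm _ _) eq))
    ... | inj₂ eq = inj₂ (x²+y²≈0⇒x≈0 eq , x²+y²≈0⇒x≈0 (trans (+-comm _ _) eq))

theorem4p9 :
    ExcludedMiddle 0ℓ →
    (ℝ : CompleteOrderedField) →
    let open CompleteOrderedField ℝ
        open Realisation ℝ
    in
    (σ : Substitution) (w : InfiniteWord) → w IsFixedBy σ →
    (∣I∣ : Letter → Carrier) →
    (∀ a → 0# < ∣I∣ a) →
    (∀ a → AlgebraicNumber (fromℝ (∣I∣ a))) →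
    let G = generatingSeries (leftEndpoint ∣I∣ w)
        A = ∣I∣ a₁ ≈ ∣I∣ a₂
        B = ∣I∣ a₁ ≉ ∣I∣ a₂ × EventuallyPeriodic w
        C = ∣I∣ a₁ ≉ ∣I∣ a₂ × ¬ EventuallyPeriodic w
    in
    ExactlyOne A B C
    × (A → EqualLengthForm (∣I∣ a₁) G)
    × (B → PeriodicForm (∣I∣ a₁) (∣I∣ a₂) G)
    × (C → TranscendentalOverℚ⟨X⟩ G)
theorem4p9 em ℝ σ w _ ∣I∣ _ _ = exactlyOne , equalLengths , periodic , transcendental
  where
  open CompleteOrderedField ℝ hiding (zero)
  open Realisation ℝ
  open ComplexNumbers em ℝ
  open LaurentSeriesOver em ℂ-ring ℂ-isDomain
  module K = CommutativeRing ℂ-ring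

  A = ∣I∣ a₁ ≈ ∣I∣ a₂
  B = ∣I∣ a₁ ≉ ∣I∣ a₂ × EventuallyPeriodic w
  C = ∣I∣ a₁ ≉ ∣I∣ a₂ × ¬ EventuallyPeriodic w
  G = generatingSeries (leftEndpoint ∣I∣ w)

  value : Letter → K.Carrier
  value = fromℝ ∘ ∣I∣

  t : ℕ → K.Carrier
  t = fromℝ ∘ leftEndpoint ∣I∣ w

  t₊ : ∀ n → t (suc n) K.≈ (t n K.+ value (w n))
  t₊ n = refl , sym (+-identityˡ 0#)

  -- The imaginary parts are `0#` and `0# - 0#`, equal only up to `≈`; hence `δ` enters
  -- `periodicForm` as a parameter with this equation.
  δ≈ : fromℝ (∣I∣ a₁ - ∣I∣ a₂) K.≈ (value a₁ K.- value a₂)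
  δ≈ = refl , sym (-‿inverseʳ 0#)

  exactlyOne : ExactlyOne A B C
  exactlyOne with em {A} | em {EventuallyPeriodic w}
  ... | yes eq | _       = inj₁ (eq , (λ (neq , _) → neq eq) , λ (neq , _) → neq eq)
  ... | no neq | yes per = inj₂ (inj₁ (neq , (neq , per) , λ (_ , ¬per) → ¬per per))
  ... | no neq | no ¬per = inj₂ (inj₂ (neq , (λ (_ , per) → ¬per per) , (neq , ¬per)))

  equalLengths : A → EqualLengthForm (∣I∣ a₁) G
  equalLengths eq = arithmeticProgression (value a₁) K.refl λ n → K.trans (t₊ n) (K.+-congˡ {t n} (same (w n)))
    where
    same : ∀ a → value a K.≈ value a₁
    same a₁ = K.refl
    same a₂ = sym eq , refl

  periodic : B → PeriodicForm (∣I∣ a₁) (∣I∣ a₂) G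
  periodic (_ , per) = periodicForm w value (fromℝ (∣I∣ a₁ - ∣I∣ a₂)) δ≈ {t} K.refl t₊ per

  ℚ[X]⇒polynomial : ∀ {F} → ℚ[X] F → PowerSeries.IsPolynomial ℂ-ring (Laurent.coeffs F)
  ℚ[X]⇒polynomial {F} (ks , _ , eq) = evalX⇒polynomial F ks eq

  transcendental : C → TranscendentalOverℚ⟨X⟩ G
  transcendental (neq , ¬per) alg = ¬per (algebraic⇒periodic w value injective {t} K.refl t₊ {ℚ⟨X⟩}
    (λ { {F} (A , B , pA , pB , eq) →
      quotient⇒rational {F} {A} {B} (ℚ[X]⇒polynomial {A} pA) (ℚ[X]⇒polynomial {B} pB) eq }) alg)
    where
    injective : ∀ {x y} → value x K.≈ value y → x ≡ y
    injective {a₁} {a₁} _        = ≡.refl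
    injective {a₁} {a₂} (eq , _) = contradiction eq neq
    injective {a₂} {a₁} (eq , _) = contradiction (sym eq) neq
    injective {a₂} {a₂} _        = ≡.refl
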